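{- There is an algorithm that, given Boolean TDDs $D$ and $D'$ over (possibly) different vtrees $(T,b)$ and $(T',b')$ on a common variable set $X$, decides whether $D\equiv D'$ in time polynomial in $|D|+|D'|$.
   Context: **Vtree.** A variable tree (vtree) over a finite variable set $X$ is a pair $(T,b)$ where $T$ is a rooted full binary tree (every node has 0 or 2 children) and $b$ is a bijection from the leaves of $T$ to $X$. **TDD.** A Tree Decision Diagram over the vtree $(T,b)$ is a tuple $D=((T,b),N,E,\mathrm{out},\lambda)$ where: - $N$ maps each $t\in V(T)$ to a finite nonempty set $N(t)$, with $N(t_1)\cap N(t_2)=\emptyset$ for $t_1\neq t_2$. - For every non-leaf $t\in V(T)$ with children $t_1,t_2$ (in an arbitrary but fixed order), $E$ assigns to each $u\in N(t)$ a set $E(u)\subseteq N(t_1)\times N(t_2)$, and the sets $\{E(u)\mid u\in N(t)\}$ form a partition of $N(t_1)\times N(t_2)$ (for distinct $u$ they are nonempty and disjoint, and together they cover everything). - $\mathrm{out}$ is a set of output labels with $|\mathrm{out}|=|N(r)|$, where $r$ is the root of $T$, and $\lambda:\mathrm{out}\to N(r)$ is a bijection. Semantics: if $t$ is a leaf with $b(t)=x$, each $u\in N(t)$ carries a label $D[u]\in\{x,\neg x,0,1\}$; for distinct $u_1,u_2\in N(t)$ the functions $D[u_1],D[u_2]$ are not simultaneously satisfiable, and (completeness) each of the two values of $x$ satisfies some $D[u]$ with $u\in N(t)$. If $t$ is not a leaf and $u\in N(t)$, then $D[u]=\bigvee_{(v,w)\in E(u)}(D[v]\wedge D[w])$. For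 $\ell\in\mathrm{out}$ put $D[\ell]:=D[\lambda(\ell)]$. The size is $|D|=\sum_{t\in V(T)}|N(t)|$. **Boolean TDD.** A TDD $D$ is Boolean if its output set is $\{0,1\}$; the function computed by $D$ is $D[1]$. $D\equiv D'$ means that $D$ and $D'$ compute the same Boolean function on $X$. -}

module Defs where

open import Data.Bool using (Bool; true; false; not; _∧_)
open import Data.Bool.ListAction using (any)
open import Data.Fin using (Fin; toℕ)
open import Data.List using (List; []; _∷_; allFin; tabulate)
open import Data.Nat using (ℕ; zero; suc; _+_; NonZero)
open import Data.Product using (∃-syntax; _×_; _,_)
open import Data.Vec using (Vec; []; _∷_; lookup)
open import Function using (_∘_; _⤖_; Bijection)
open import Relation.Binary.PropositionalEquality using (_≡_; refl)

------------------------------------------------------------------------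
-- Vtrees.  The finite variable set X is Fin n.

data Shape : Set where
  leaf : Shape
  node : Shape → Shape → Shape

data Leaf : Shape → Set where
  here  : Leaf leaf
  left  : ∀ {S₁ S₂} → Leaf S₁ → Leaf (node S₁ S₂)
  right : ∀ {S₁ S₂} → Leaf S₂ → Leaf (node S₁ S₂)

record Vtree (n : ℕ) : Set where
  field
    shape    : Shape
    labeling : Leaf shape ⤖ Fin n

  var : Leaf shape → Fin n
  var = Bijection.to labeling

------------------------------------------------------------------------
-- Tree decision diagrams

data Label : Set where
  pos neg bot top : Label

-- The value of a leaf label at a given value of the variable of that leaf.
⟦_⟧ : Label → Bool → Bool
⟦ pos ⟧ x = x
⟦ neg ⟧ x = not x
⟦ bot ⟧ _ = false
⟦ top ⟧ _ = true

record IsLeafLabeling {w : ℕ} (label : Fin w → Label) : Set where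
  field
    exclusive : ∀ {u₁ u₂} x → ⟦ label u₁ ⟧ x ≡ true → ⟦ label u₂ ⟧ x ≡ true → u₁ ≡ u₂
    complete  : ∀ x → ∃[ u ] ⟦ label u ⟧ x ≡ true

-- E u is the characteristic function of a subset of Fin w₁ × Fin w₂.
record IsPartition {w w₁ w₂ : ℕ} (E : Fin w → Fin w₁ → Fin w₂ → Bool) : Set where
  field
    nonempty : ∀ u → ∃[ v₁ ] ∃[ v₂ ] E u v₁ v₂ ≡ true
    disjoint : ∀ {u u′} v₁ v₂ → E u v₁ v₂ ≡ true → E u′ v₁ v₂ ≡ true → u ≡ u′
    covering : ∀ v₁ v₂ → ∃[ u ] E u v₁ v₂ ≡ true

-- Diagram S w consists of the families N, E and the leaf labels over all
-- vertices of S, where N(t) is Fin w at the root t of S.  The sets N(t) for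
-- different t are disjoint because each occurrence of a subtree has its own.
data Diagram : Shape → ℕ → Set where
  leaf : ∀ {w} .{{_ : NonZero w}}
         (label : Fin w → Label) → IsLeafLabeling label →
         Diagram leaf w
  node : ∀ {S₁ S₂ w w₁ w₂} .{{_ : NonZero w}} →
         Diagram S₁ w₁ → Diagram S₂ w₂ →
         (E : Fin w → Fin w₁ → Fin w₂ → Bool) → IsPartition E →
         Diagram (node S₁ S₂) w

-- eval D α u is the value of the function D[u] when the variable at each
-- leaf is given its value under α.
eval : ∀ {S w} → Diagram S w → (Leaf S → Bool) → Fin w → Bool
eval (leaf label _) α u = ⟦ label u ⟧ (α here)
eval (node {w₁ = w₁} {w₂ = w₂} D₁ D₂ E _) α u =
  any (λ v₁ → any (λ v₂ → E u v₁ v₂ ∧ (eval D₁ (α ∘ left) v₁ ∧ eval D₂ (α ∘ right) v₂))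
                  (allFin w₂))
      (allFin w₁)

∣_∣ᴰ : ∀ {S w} → Diagram S w → ℕ
∣ leaf {w = w} _ _ ∣ᴰ       = w
∣ node {w = w} D₁ D₂ _ _ ∣ᴰ = w + (∣ D₁ ∣ᴰ + ∣ D₂ ∣ᴰ)

record TDD {n : ℕ} (V : Vtree n) (Out : Set) : Set where
  open Vtree V
  field
    {width} : ℕ
    diagram : Diagram shape width
    output  : Out ⤖ Fin width

  outNode : Out → Fin width
  outNode = Bijection.to output

  size : ℕ
  size = ∣ diagram ∣ᴰ

  value : Out → (Fin n → Bool) → Bool
  value ℓ a = eval diagram (a ∘ var) (outNode ℓ)

BooleanTDD : {n : ℕ} → Vtree n → Set
BooleanTDD V = TDD V Bool

computes : ∀ {n} {V : Vtree n} → BooleanTDD V → (Fin n → Bool) → Bool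
computes D = TDD.value D true

infix 4 _≋_

_≋_ : ∀ {n} {V V′ : Vtree n} → BooleanTDD V → BooleanTDD V′ → Set
D ≋ D′ = ∀ a → computes D a ≡ computes D′ a

------------------------------------------------------------------------
-- Model of computation: first-order recursive functions (call by value) on
-- binary trees, where every evaluation step has unit cost.
--
-- Each rule allocates at most one cell, inspects at most the top of one value
-- and copies boundedly many pointers (the bound depending on the program
-- only), so with values represented as pointers into a shared heap a run of
-- cost c is simulated by a Turing machine in time polynomial in c and the
-- input size.  Conversely, Turing machines run with constant overhead per
-- step.  Hence "polynomial time" is the usual notion.

infixr 5 _∙_

data Tree : Set where
  nil : Tree
  _∙_ : Tree → Tree → Tree

-- Expressions over k variables (de Bruijn indices) and function symbols
-- Fin m of the given arities.
data Exp {m : ℕ} (arity : Fin m → ℕ) (k : ℕ) : Set where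
  var   : Fin k → Exp arity k
  nil   : Exp arity k
  _∙_   : Exp arity k → Exp arity k → Exp arity k
  let′  : Exp arity k → Exp arity (suc k) → Exp arity k
  match : Exp arity k → Exp arity k → Exp arity (suc (suc k)) → Exp arity k
  call  : (f : Fin m) → Vec (Exp arity k) (arity f) → Exp arity k

record Program : Set where
  field
    {functions} : ℕ
    arity       : Fin functions → ℕ
    body        : (f : Fin functions) → Exp arity (arity f)
    main        : Exp arity 1

module Evaluation {m : ℕ} {arity : Fin m → ℕ}
                  (body : (f : Fin m) → Exp arity (arity f)) where

  infix 4 _⊢_⇓_cost_ _⊢_⇓*_cost_

  mutual
    -- ρ ⊢ e ⇓ v cost c : in environment ρ, e evaluates to v in c steps.
    data _⊢_⇓_cost_ {k : ℕ} (ρ : Vec Tree k) : Exp arity k → Tree → ℕ → Set where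
      var   : ∀ i → ρ ⊢ var i ⇓ lookup ρ i cost 1
      nil   : ρ ⊢ nil ⇓ nil cost 1
      _∙_   : ∀ {e₁ e₂ v₁ v₂ c₁ c₂} →
              ρ ⊢ e₁ ⇓ v₁ cost c₁ →
              ρ ⊢ e₂ ⇓ v₂ cost c₂ →
              ρ ⊢ e₁ ∙ e₂ ⇓ v₁ ∙ v₂ cost suc (c₁ + c₂)
      let′  : ∀ {e₁ e₂ v₁ v₂ c₁ c₂} →
              ρ ⊢ e₁ ⇓ v₁ cost c₁ →
              (v₁ ∷ ρ) ⊢ e₂ ⇓ v₂ cost c₂ →
              ρ ⊢ let′ e₁ e₂ ⇓ v₂ cost suc (c₁ + c₂)
      match-nil : ∀ {e e₀ e₁ v c c₀} →
              ρ ⊢ e ⇓ nil cost c →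
              ρ ⊢ e₀ ⇓ v cost c₀ →
              ρ ⊢ match e e₀ e₁ ⇓ v cost suc (c + c₀)
      match-∙ : ∀ {e e₀ e₁ v₁ v₂ v c c₁} →
              ρ ⊢ e ⇓ v₁ ∙ v₂ cost c →
              (v₁ ∷ v₂ ∷ ρ) ⊢ e₁ ⇓ v cost c₁ →
              ρ ⊢ match e e₀ e₁ ⇓ v cost suc (c + c₁)
      call  : ∀ {f es vs v c c′} →
              ρ ⊢ es ⇓* vs cost c →
              vs ⊢ body f ⇓ v cost c′ →
              ρ ⊢ call f es ⇓ v cost suc (c + c′)

    data _⊢_⇓*_cost_ {k : ℕ} (ρ : Vec Tree k) :
         ∀ {l} → Vec (Exp arity k) l → Vec Tree l → ℕ → Set where
      []  : ρ ⊢ [] ⇓* [] cost 0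
      _∷_ : ∀ {l e v c c′} {es : Vec (Exp arity k) l} {vs : Vec Tree l} →
            ρ ⊢ e ⇓ v cost c →
            ρ ⊢ es ⇓* vs cost c′ →
            ρ ⊢ e ∷ es ⇓* v ∷ vs cost (c + c′)

  deterministic : ∀ {k} {ρ : Vec Tree k} {e v v′ c c′} →
                  ρ ⊢ e ⇓ v cost c → ρ ⊢ e ⇓ v′ cost c′ → v ≡ v′ × c ≡ c′
  deterministic* : ∀ {k l} {ρ : Vec Tree k} {es : Vec (Exp arity k) l} {vs vs′ c c′} →
                   ρ ⊢ es ⇓* vs cost c → ρ ⊢ es ⇓* vs′ cost c′ → vs ≡ vs′ × c ≡ c′
  deterministic (var _) (var _) = refl , refl
  deterministic nil nil = refl , refl
  deterministic (p ∙ q) (p′ ∙ q′)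
    with refl , refl ← deterministic p p′ | refl , refl ← deterministic q q′ = refl , refl
  deterministic (let′ p q) (let′ p′ q′)
    with refl , refl ← deterministic p p′
    with refl , refl ← deterministic q q′ = refl , refl
  deterministic (match-nil p q) (match-nil p′ q′)
    with refl , refl ← deterministic p p′ | refl , refl ← deterministic q q′ = refl , refl
  deterministic (match-nil p _) (match-∙ p′ _) with () , _ ← deterministic p p′
  deterministic (match-∙ p _) (match-nil p′ _) with () , _ ← deterministic p p′
  deterministic (match-∙ p q) (match-∙ p′ q′)
    with refl , refl ← deterministic p p′
    with refl , refl ← deterministic q q′ = refl , refl
  deterministic (call p q) (call p′ q′)
    with refl , refl ← deterministic* p p′
    with refl , refl ← deterministic q q′ = refl , refl
  deterministic* [] [] = refl , refl
  deterministic* (p ∷ ps) (p′ ∷ ps′)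
    with refl , refl ← deterministic p p′ | refl , refl ← deterministic* ps ps′ = refl , refl

infix 4 _on_yields_inTime_

_on_yields_inTime_ : Program → Tree → Tree → ℕ → Set
P on input yields output inTime c = (input ∷ []) ⊢ main ⇓ output cost c
  where
  open Program P
  open Evaluation body

------------------------------------------------------------------------
-- Encoding of the inputs and outputs as binary trees.  Numbers are in unary
-- and E(u) is given by its characteristic matrix; as the number of variables
-- and all node sets are bounded by the size of the diagram, the encoding is
-- polynomial in that size.

encodeBool : Bool → Tree
encodeBool false = nil
encodeBool true  = nil ∙ nil

encodeℕ : ℕ → Tree
encodeℕ zero    = nil
encodeℕ (suc n) = nil ∙ encodeℕ n

encodeFin : ∀ {n} → Fin n → Tree
encodeFin i = encodeℕ (toℕ i)

-- A label is given by its truth table.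
encodeLabel : Label → Tree
encodeLabel ℓ = encodeBool (⟦ ℓ ⟧ false) ∙ encodeBool (⟦ ℓ ⟧ true)

encodeList : {A : Set} → (A → Tree) → List A → Tree
encodeList enc []       = nil
encodeList enc (x ∷ xs) = enc x ∙ encodeList enc xs

encodeFamily : ∀ {n} {A : Set} → (A → Tree) → (Fin n → A) → Tree
encodeFamily enc f = encodeList enc (tabulate f)

encodeDiagram : ∀ {n S w} → (Leaf S → Fin n) → Diagram S w → Tree
encodeDiagram b (leaf label _) =
  nil ∙ encodeFin (b here) ∙ encodeFamily encodeLabel label
encodeDiagram b (node D₁ D₂ E _) =
  (nil ∙ nil) ∙ encodeDiagram (b ∘ left) D₁ ∙ encodeDiagram (b ∘ right) D₂
              ∙ encodeFamily (encodeFamily (encodeFamily encodeBool)) E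

encodeTDD : ∀ {n} {V : Vtree n} → BooleanTDD V → Tree
encodeTDD {V = V} D =
  encodeFin (outNode false) ∙ encodeFin (outNode true) ∙ encodeDiagram (Vtree.var V) diagram
  where open TDD D

{-# OPTIONS --safe #-}

-- Every node u of D groups the assignments α of the variables below it on
-- which D cannot tell the difference.  Hence D ≋ D′ holds iff D′ cannot tell
-- them apart either and D, D′ agree on one representative per root node.
-- It suffices to keep one representative of each node and to compare it, at
-- an inner node u, with the gluings of the representatives of v and w for all
-- (v , w) ∈ E u: any α reaching u is turned into the representative of u by
-- replacing first its left half, then its right half, then the gluing.
--
-- Each comparison asks whether D′ restricted by α and D′ restricted by α′ are
-- the same function.  Both restrictions live on the vtree of D′, so the pairs
-- of nodes they reach under a common assignment of the remaining variables
-- can be computed bottom-up; no such pair at the root may separate the outputs.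
module Submission where

open import Defs
open import Data.Bool using (Bool; true; false; not; _∧_; _∨_; if_then_else_)
open import Data.Bool.ListAction using (any; all)
open import Data.Bool.Properties using (T-≡; ⇔→≡)
open import Data.Fin using (Fin; zero; suc; toℕ; #_)
open import Data.Fin.Patterns using (0F; 1F)
open import Data.Fin.Permutation using (↔⇒≡)
open import Data.Fin.Properties using (_≟_; toℕ<n; toℕ-injective; injective⇒≤; 2↔Bool)
open import Data.List using (List; []; _∷_; _++_; foldr; length; map; allFin)
import Data.List as List
open import Data.List.Membership.Propositional using (_∈_)
open import Data.List.Membership.Propositional.Properties
  using (∈-allFin; ∈-map⁺; ∈-++⁺ˡ; ∈-++⁺ʳ)
open import Data.List.Properties using (length-tabulate; length-++; length-map; map-tabulate)
open import Data.List.Relation.Unary.All using (All; []; _∷_)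
import Data.List.Relation.Unary.All as All
open import Data.List.Relation.Unary.Any using (here; there; index)
open import Data.List.Relation.Unary.Any.Properties using (lookup-index)
open import Data.Nat
  using (ℕ; zero; suc; NonZero; _+_; _*_; _^_; _≤_; z≤n; s≤s; _≡ᵇ_; _<?_)
open import Data.Nat.Properties hiding (_≟_)
open import Data.Nat.Tactic.RingSolver using (solve-∀)
open import Data.Product using (Σ-syntax; ∃-syntax; _×_; _,_; proj₁; proj₂)
open import Data.Product.Properties using (,-injective; ,-injectiveˡ; ,-injectiveʳ)
open import Data.Sum using (_⊎_; inj₁; inj₂; swap)
open import Data.Vec using (Vec; []; _∷_; lookup)
open import Function using (_∘_; id; _⇔_; mk⇔; Equivalence; _⤖_; Bijection; Injective)
open import Function.Construct.Composition using (_↔-∘_)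
open import Function.Properties.Bijection using (⤖⇒↔)
open import Relation.Binary.PropositionalEquality
  using (_≡_; _≢_; _≗_; refl; sym; trans; cong; cong₂; subst)
open import Relation.Nullary using (Dec; yes; no; does; ¬_; contradiction)
open import Relation.Nullary.Decidable using (True)

-- The variables below a vertex of the first vtree may be scattered over the whole second vtree, so
-- there is no common recursion in which a product of the two diagrams could be built. This is why
-- two restrictions of the same `D′` are compared instead of a part of `D` with a part of `D′`. Such
-- a comparison is cheap by determinism: an assignment reaches exactly one node at each vertex of
-- `D′`, so a pair of restrictions is summarised there by a relation on the node set, of size
-- quadratic in its width. Two restrictions count as equal only if they agree for all values of the
-- remaining variables. This strength is what lets a verdict about one half of an assignment be used
-- with any other half: the other half is just a part of the remaining variables. The number of
-- comparisons stays polynomial because a node gets at most one candidate per pair of child nodes,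
-- however many assignments reach it.

∧-true⁻ : ∀ x {y} → x ∧ y ≡ true → x ≡ true × y ≡ true
∧-true⁻ true eq = refl , eq

∧-true⁺ : ∀ {x y} → x ≡ true → y ≡ true → x ∧ y ≡ true
∧-true⁺ refl refl = refl

≡ᵇ-complete : ∀ {m n} → m ≡ n → (m ≡ᵇ n) ≡ true
≡ᵇ-complete {m} {n} eq = Equivalence.to T-≡ (≡⇒≡ᵇ m n eq)

≡ᵇ-sound : ∀ {m n} → (m ≡ᵇ n) ≡ true → m ≡ n
≡ᵇ-sound {m} {n} eq = ≡ᵇ⇒≡ m n (Equivalence.from T-≡ eq)

module _ {A : Set} where

  any-true⁺ : (p : A → Bool) → ∀ {x xs} → x ∈ xs → p x ≡ true → any p xs ≡ true
  any-true⁺ p {xs = y ∷ _} (here refl) px rewrite px = refl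
  any-true⁺ p {xs = y ∷ _} (there x∈)  px with p y
  ... | true  = refl
  ... | false = any-true⁺ p x∈ px

  any-true⁻ : (p : A → Bool) → ∀ xs → any p xs ≡ true → ∃[ x ] x ∈ xs × p x ≡ true
  any-true⁻ p (y ∷ xs) eq with p y in py
  ... | true  = y , here refl , py
  ... | false with x , x∈ , px ← any-true⁻ p xs eq = x , there x∈ , px

  all-true⁺ : (p : A → Bool) → ∀ {xs} → All (λ x → p x ≡ true) xs → all p xs ≡ true
  all-true⁺ p []        = refl
  all-true⁺ p (px ∷ ps) = ∧-true⁺ px (all-true⁺ p ps)

  all-true⁻ : (p : A → Bool) → ∀ {x xs} → all p xs ≡ true → x ∈ xs → p x ≡ true
  all-true⁻ p {xs = x ∷ _} eq (here refl) = proj₁ (∧-true⁻ (p x) eq)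
  all-true⁻ p {xs = x ∷ _} eq (there x∈)  = all-true⁻ p (proj₂ (∧-true⁻ (p x) eq)) x∈

any-allFin⁺ : ∀ {w} (p : Fin w → Bool) u → p u ≡ true → any p (allFin w) ≡ true
any-allFin⁺ p u = any-true⁺ p (∈-allFin u)

any-allFin⁻ : ∀ {w} (p : Fin w → Bool) → any p (allFin w) ≡ true → ∃[ u ] p u ≡ true
any-allFin⁻ {w} p eq with u , _ , pu ← any-true⁻ p (allFin w) eq = u , pu

-- Invariants, membership and length for right folds

module _ {A B : Set} (f : A → List B → List B) (ys : List B) where

  foldr-All : {P : B → Set} → (∀ x zs → All P zs → All P (f x zs)) → All P ys →
              ∀ xs → All P (foldr f ys xs)
  foldr-All step base []       = base
  foldr-All step base (x ∷ xs) = step x _ (foldr-All step base xs)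

  foldr-∈ : (∀ x zs {z} → z ∈ zs → z ∈ f x zs) →
            ∀ {x y xs} → x ∈ xs → (∀ zs → y ∈ f x zs) → y ∈ foldr f ys xs
  foldr-∈ mono (here refl) new = new _
  foldr-∈ mono (there x∈)  new = mono _ _ (foldr-∈ mono x∈ new)

  foldr-⊇ : (∀ x zs {z} → z ∈ zs → z ∈ f x zs) → ∀ xs {z} → z ∈ ys → z ∈ foldr f ys xs
  foldr-⊇ mono []       z∈ = z∈
  foldr-⊇ mono (x ∷ xs) z∈ = mono _ _ (foldr-⊇ mono xs z∈)

  length-foldr : ∀ {k} → (∀ x zs → length (f x zs) ≤ k + length zs) →
                 ∀ xs → length (foldr f ys xs) ≤ length xs * k + length ys
  length-foldr     step []       = ≤-refl
  length-foldr {k} step (x ∷ xs) =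
    ≤-trans (step x _)
      (≤-trans (+-monoʳ-≤ k (length-foldr step xs))
        (≤-reflexive (sym (+-assoc k (length xs * k) (length ys)))))

withHead : {A B : Set} → List A → B → (A → B) → B
withHead []      b f = b
withHead (x ∷ _) b f = f x

-- The node reached by an assignment

class : ∀ {S w} → Diagram S w → (Leaf S → Bool) → Fin w
class (leaf _ L)         α = proj₁ (IsLeafLabeling.complete L (α here))
class (node D₁ D₂ _ E-P) α =
  proj₁ (IsPartition.covering E-P (class D₁ (α ∘ left)) (class D₂ (α ∘ right)))

E-class : ∀ {w w₁ w₂} {E : Fin w → Fin w₁ → Fin w₂ → Bool} (P : IsPartition E) {u v₁ v₂} →
          E u v₁ v₂ ≡ true → proj₁ (IsPartition.covering P v₁ v₂) ≡ u
E-class P {v₁ = v₁} {v₂} eq = disjoint v₁ v₂ (proj₂ (covering v₁ v₂)) eq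
  where open IsPartition P

class-cong : ∀ {S w} (D : Diagram S w) {α β} → α ≗ β → class D α ≡ class D β
class-cong (leaf _ L)         α≗β = cong (λ x → proj₁ (IsLeafLabeling.complete L x)) (α≗β here)
class-cong (node D₁ D₂ _ E-P) α≗β =
  cong₂ (λ v₁ v₂ → proj₁ (IsPartition.covering E-P v₁ v₂))
        (class-cong D₁ (α≗β ∘ left)) (class-cong D₂ (α≗β ∘ right))

eval-class : ∀ {S w} (D : Diagram S w) α → eval D α (class D α) ≡ true
eval-class (leaf _ L)         α = proj₂ (IsLeafLabeling.complete L (α here))
eval-class (node D₁ D₂ _ E-P) α =
  any-allFin⁺ _ (class D₁ _) (any-allFin⁺ _ (class D₂ _)
    (∧-true⁺ (proj₂ (IsPartition.covering E-P _ _))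
             (∧-true⁺ (eval-class D₁ _) (eval-class D₂ _))))

eval⇒class : ∀ {S w} (D : Diagram S w) α {u} → eval D α u ≡ true → class D α ≡ u
eval⇒class (leaf _ L) α eq =
  IsLeafLabeling.exclusive L (α here) (proj₂ (IsLeafLabeling.complete L (α here))) eq
eval⇒class (node D₁ D₂ E E-P) α eq
  with v₁ , eq ← any-allFin⁻ _ eq
  with v₂ , eq ← any-allFin⁻ _ eq
  with e , eq ← ∧-true⁻ (E _ v₁ v₂) eq
  with e₁ , e₂ ← ∧-true⁻ (eval D₁ (α ∘ left) v₁) eq
  with refl ← eval⇒class D₁ (α ∘ left) e₁ | refl ← eval⇒class D₂ (α ∘ right) e₂
  = E-class E-P e

eval⇔class : ∀ {S w} (D : Diagram S w) α u → eval D α u ≡ true ⇔ class D α ≡ u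
eval⇔class D α u = mk⇔ (eval⇒class D α) λ { refl → eval-class D α }

-- Pairs of nodes reached by linked pairs of assignments

-- V lists the pairs of values that the two assignments may take at a leaf.
reach : ∀ {S w} → Diagram S w → (Leaf S → List (Bool × Bool)) → Fin w → Fin w → Bool
reach (leaf label _) V u u′ =
  any (λ (x , x′) → ⟦ label u ⟧ x ∧ ⟦ label u′ ⟧ x′) (V here)
reach (node {w₁ = w₁} {w₂ = w₂} D₁ D₂ E _) V u u′ =
  any (λ v₁ → any (λ v₁′ →
    reach D₁ (V ∘ left) v₁ v₁′ ∧
    any (λ v₂ → E u v₁ v₂ ∧
      any (λ v₂′ → reach D₂ (V ∘ right) v₂ v₂′ ∧ E u′ v₁′ v₂′)
    (allFin w₂)) (allFin w₂)) (allFin w₁)) (allFin w₁)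

Linked : ∀ {X : Set} → (X → List (Bool × Bool)) → (X → Bool) → (X → Bool) → Set
Linked V α α′ = ∀ l → (α l , α′ l) ∈ V l

reach⁺ : ∀ {S w} (D : Diagram S w) {V α α′} → Linked V α α′ →
         reach D V (class D α) (class D α′) ≡ true
reach⁺ (leaf label L) {α = α} {α′} p =
  any-true⁺ _ (p here) (∧-true⁺ (proj₂ (IsLeafLabeling.complete L (α here)))
                                (proj₂ (IsLeafLabeling.complete L (α′ here))))
reach⁺ (node D₁ D₂ E E-P) p =
  any-allFin⁺ _ (class D₁ _) (any-allFin⁺ _ (class D₁ _)
    (∧-true⁺ (reach⁺ D₁ (p ∘ left))
      (any-allFin⁺ _ (class D₂ _) (∧-true⁺ (proj₂ (IsPartition.covering E-P _ _))
        (any-allFin⁺ _ (class D₂ _)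
          (∧-true⁺ (reach⁺ D₂ (p ∘ right)) (proj₂ (IsPartition.covering E-P _ _))))))))

glue : ∀ {S₁ S₂} {A : Set} → (Leaf S₁ → A) → (Leaf S₂ → A) → Leaf (node S₁ S₂) → A
glue α₁ α₂ (left l)  = α₁ l
glue α₁ α₂ (right l) = α₂ l

-- Being linked is a condition on each leaf separately, so linked pairs for the two subtrees glue to
-- a linked pair for the whole. Hence the bottom-up computation is exact and not merely an
-- over-approximation.
reach⁻ : ∀ {S w} (D : Diagram S w) {V u u′} → reach D V u u′ ≡ true →
         ∃[ α ] ∃[ α′ ] Linked V α α′ × class D α ≡ u × class D α′ ≡ u′
reach⁻ (leaf label L) {V} eq
  with (x , x′) , x∈ , e ← any-true⁻ _ (V here) eq
  with e₁ , e₂ ← ∧-true⁻ (⟦ label _ ⟧ x) e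
  = (λ _ → x) , (λ _ → x′) , (λ { here → x∈ })
  , IsLeafLabeling.exclusive L x (proj₂ (IsLeafLabeling.complete L x)) e₁
  , IsLeafLabeling.exclusive L x′ (proj₂ (IsLeafLabeling.complete L x′)) e₂
reach⁻ (node D₁ D₂ E E-P) {V} eq
  with v₁ , eq ← any-allFin⁻ _ eq
  with v₁′ , eq ← any-allFin⁻ _ eq
  with r₁ , eq ← ∧-true⁻ (reach D₁ (V ∘ left) v₁ v₁′) eq
  with v₂ , eq ← any-allFin⁻ _ eq
  with e , eq ← ∧-true⁻ (E _ v₁ v₂) eq
  with v₂′ , eq ← any-allFin⁻ _ eq
  with r₂ , e′ ← ∧-true⁻ (reach D₂ (V ∘ right) v₂ v₂′) eq
  with α₁ , α₁′ , p₁ , refl , refl ← reach⁻ D₁ r₁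
  with α₂ , α₂′ , p₂ , refl , refl ← reach⁻ D₂ r₂
  = glue α₁ α₂ , glue α₁′ α₂′ , (λ { (left l) → p₁ l ; (right l) → p₂ l })
  , E-class E-P e , E-class E-P e′

-- Partial assignments

leaves : ∀ S → List (Leaf S)
leaves leaf         = here ∷ []
leaves (node S₁ S₂) = map left (leaves S₁) ++ map right (leaves S₂)

∈-leaves : ∀ {S} (l : Leaf S) → l ∈ leaves S
∈-leaves here = here refl
∈-leaves (left l)  = ∈-++⁺ˡ (∈-map⁺ left (∈-leaves l))
∈-leaves (right {S₁} l) = ∈-++⁺ʳ (map left (leaves S₁)) (∈-map⁺ right (∈-leaves l))

leaf-of? : ∀ {n} S (b : Leaf S → Fin n) x → Dec (∃[ l ] b l ≡ x)
leaf-of? leaf b x with b here ≟ x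
... | yes eq = yes (here , eq)
... | no neq = no λ { (here , eq) → neq eq }
leaf-of? (node S₁ S₂) b x with leaf-of? S₁ (b ∘ left) x | leaf-of? S₂ (b ∘ right) x
... | yes (l , eq) | _            = yes (left l , eq)
... | no _         | yes (l , eq) = yes (right l , eq)
... | no ¬l        | no ¬r        = no λ { (left l , eq) → ¬l (l , eq) ; (right l , eq) → ¬r (l , eq) }

module _ {S n} (b : Leaf S → Fin n) where

  patch : (Leaf S → Bool) → (Fin n → Bool) → Fin n → Bool
  patch α a x with leaf-of? S b x
  ... | yes (l , _) = α l
  ... | no _        = a x

  patch-out : ∀ α a {x} → ¬ (∃[ l ] b l ≡ x) → patch α a x ≡ a x
  patch-out α a {x} ∉ with leaf-of? S b x
  ... | yes l∈ = contradiction l∈ ∉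
  ... | no _  = refl

  -- Variables in the image of b are fixed by α and α′, the others are free but
  -- have to take the same value on both sides.
  linked : (α α′ : Leaf S → Bool) → Fin n → List (Bool × Bool)
  linked α α′ x =
    foldr (λ l r → if toℕ x ≡ᵇ toℕ (b l) then (α l , α′ l) ∷ [] else r)
          ((false , false) ∷ (true , true) ∷ []) (leaves S)

  linked-out : ∀ α α′ {x} → ¬ (∃[ l ] b l ≡ x) →
               linked α α′ x ≡ (false , false) ∷ (true , true) ∷ []
  linked-out α α′ {x} ∉ = go (leaves S)
    where
    go : ∀ ls → foldr (λ l r → if toℕ x ≡ᵇ toℕ (b l) then (α l , α′ l) ∷ [] else r)
                      ((false , false) ∷ (true , true) ∷ []) ls ≡ (false , false) ∷ (true , true) ∷ []
    go []       = refl
    go (l ∷ ls) with toℕ x ≡ᵇ toℕ (b l) in eq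
    ... | true  = contradiction (l , sym (toℕ-injective (≡ᵇ-sound eq))) ∉
    ... | false = go ls

  module _ (b-inj : Injective _≡_ _≡_ b) where

    patch-in : ∀ α a l → patch α a (b l) ≡ α l
    patch-in α a l with leaf-of? S b (b l)
    ... | yes (_ , eq) = cong α (b-inj eq)
    ... | no ∉         = contradiction (l , refl) ∉

    patch-unique : ∀ α a a′ → (∀ l → a′ (b l) ≡ α l) →
                   (∀ x → ¬ (∃[ l ] b l ≡ x) → a′ x ≡ a x) → patch α a ≗ a′
    patch-unique α a a′ in′ out′ x with leaf-of? S b x
    ... | yes (l , refl) = sym (in′ l)
    ... | no ∉           = sym (out′ x ∉)

    linked-in : ∀ α α′ l → linked α α′ (b l) ≡ (α l , α′ l) ∷ []
    linked-in α α′ l = go (∈-leaves l)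
      where
      go : ∀ {ls} → l ∈ ls →
           foldr (λ l′ r → if toℕ (b l) ≡ᵇ toℕ (b l′) then (α l′ , α′ l′) ∷ [] else r)
                 ((false , false) ∷ (true , true) ∷ []) ls ≡ (α l , α′ l) ∷ []
      go (here refl) rewrite ≡ᵇ-complete {toℕ (b l)} refl = refl
      go {l′ ∷ _} (there l∈) with toℕ (b l) ≡ᵇ toℕ (b l′) in eq
      ... | true  rewrite b-inj (toℕ-injective (≡ᵇ-sound eq)) = refl
      ... | false = go l∈

    patch-linked : ∀ α α′ a → Linked (linked α α′) (patch α a) (patch α′ a)
    patch-linked α α′ a x with leaf-of? S b x
    ... | yes (l , refl) rewrite linked-in α α′ l = here refl
    ... | no ∉ rewrite linked-out α α′ ∉ with a x
    ...   | false = here refl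
    ...   | true  = there (here refl)

    -- Together with `patch-linked` this identifies the linked pairs as the pairs of extensions of
    -- `α` and `α′` by one common assignment. The common assignment can be `a` itself: it already
    -- agrees with `α` on the fixed variables, and with `a′` on the free ones.
    linked-patch : ∀ α α′ {a a′} → Linked (linked α α′) a a′ →
                   patch α a ≗ a × patch α′ a ≗ a′
    linked-patch α α′ {a} {a′} p =
      patch-unique α a a (proj₁ ∘ values) (λ _ _ → refl) ,
      patch-unique α′ a a′ (proj₂ ∘ values) free
      where
      values : ∀ l → a (b l) ≡ α l × a′ (b l) ≡ α′ l
      values l with p (b l)
      ... | q rewrite linked-in α α′ l with here eq ← q = ,-injective eq
      free : ∀ x → ¬ (∃[ l ] b l ≡ x) → a′ x ≡ a x
      free x ∉ with p x
      ... | q rewrite linked-out α α′ ∉ with q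
      ...   | here eq         = trans (,-injectiveʳ eq) (sym (,-injectiveˡ eq))
      ...   | there (here eq) = trans (,-injectiveʳ eq) (sym (,-injectiveˡ eq))

  patch-self : ∀ a → patch (a ∘ b) a ≗ a
  patch-self a x with leaf-of? S b x
  ... | yes (l , refl) = refl
  ... | no _           = refl

patch-cong : ∀ {S n} (b : Leaf S → Fin n) α {a a′} → a ≗ a′ → patch b α a ≗ patch b α a′
patch-cong {S} b α eq x with leaf-of? S b x
... | yes _ = refl
... | no _  = eq x

-- Both inner patches copy values of the same `α`, so their order is immaterial. Abstracting from
-- `left` and `right` yields both orders, which are needed because either half has to be the outer
-- patch when it is replaced.
patch-split : ∀ {S S₁ S₂ n} (b : Leaf S → Fin n) → Injective _≡_ _≡_ b →
  (f : Leaf S₁ → Leaf S) (g : Leaf S₂ → Leaf S) →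
  (∀ l → (∃[ l₁ ] f l₁ ≡ l) ⊎ (∃[ l₂ ] g l₂ ≡ l)) →
  ∀ α a → patch b α a ≗ patch (b ∘ f) (α ∘ f) (patch (b ∘ g) (α ∘ g) a)
patch-split {S} {S₁} {S₂} b b-inj f g cover α a x with leaf-of? S₁ (b ∘ f) x
... | yes (l , refl) = patch-in b b-inj α a (f l)
... | no ∉f with leaf-of? S₂ (b ∘ g) x
...   | yes (l , refl) = patch-in b b-inj α a (g l)
...   | no ∉g = patch-out b α a λ (l , eq) → out l eq (cover l)
  where
  out : ∀ l → b l ≡ x → ¬ ((∃[ l₁ ] f l₁ ≡ l) ⊎ (∃[ l₂ ] g l₂ ≡ l))
  out l eq (inj₁ (l₁ , refl)) = ∉f (l₁ , eq)
  out l eq (inj₂ (l₂ , refl)) = ∉g (l₂ , eq)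

left-or-right : ∀ {S₁ S₂} (l : Leaf (node S₁ S₂)) → (∃[ l₁ ] left l₁ ≡ l) ⊎ (∃[ l₂ ] right l₂ ≡ l)
left-or-right (left l)  = inj₁ (l , refl)
left-or-right (right l) = inj₂ (l , refl)

module _ {S₁ S₂ : Shape} {n : ℕ} (b : Leaf (node S₁ S₂) → Fin n) (b-inj : Injective _≡_ _≡_ b) where

  left-inj : Injective _≡_ _≡_ (b ∘ left)
  left-inj eq with refl ← b-inj eq = refl

  right-inj : Injective _≡_ _≡_ (b ∘ right)
  right-inj eq with refl ← b-inj eq = refl

  patch-node : ∀ α a →
    patch b α a ≗ patch (b ∘ left) (α ∘ left) (patch (b ∘ right) (α ∘ right) a)
  patch-node = patch-split b b-inj left right left-or-right

  patch-node′ : ∀ α a →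
    patch b α a ≗ patch (b ∘ right) (α ∘ right) (patch (b ∘ left) (α ∘ left) a)
  patch-node′ = patch-split b b-inj right left (swap ∘ left-or-right)

-- Candidate representatives of the nodes

module _ {S₁ S₂ : Shape} {w₂ : ℕ} where

  -- Only the heads of the lists of the children are glued. Gluing all their candidates would
  -- multiply the lengths at every level of the vtree and become exponential.
  extend : (Fin w₂ → Bool) → (Fin w₂ → List (Leaf S₂ → Bool)) → (Leaf S₁ → Bool) →
           Fin w₂ → List (Leaf (node S₁ S₂) → Bool) → List (Leaf (node S₁ S₂) → Bool)
  extend R C₂ α₁ v₂ r = if R v₂ then withHead (C₂ v₂) r (λ α₂ → glue α₁ α₂ ∷ r) else r

  extendAll : ∀ {w₁} → (Fin w₁ → Fin w₂ → Bool) →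
              (Fin w₁ → List (Leaf S₁ → Bool)) → (Fin w₂ → List (Leaf S₂ → Bool)) →
              Fin w₁ → List (Leaf (node S₁ S₂) → Bool) → List (Leaf (node S₁ S₂) → Bool)
  extendAll R C₁ C₂ v₁ r = withHead (C₁ v₁) r λ α₁ → foldr (extend (R v₁) C₂ α₁) r (allFin w₂)

-- The first candidate of a node is its representative; the list is empty iff
-- the node is unsatisfiable (which the leaf label bot permits).
candidates : ∀ {S w} → Diagram S w → Fin w → List (Leaf S → Bool)
candidates (leaf label _) u =
  if ⟦ label u ⟧ false then (λ _ → false) ∷ atTrue else atTrue
  where
  atTrue : List (Leaf leaf → Bool)
  atTrue = if ⟦ label u ⟧ true then (λ _ → true) ∷ [] else []
candidates (node {w₁ = w₁} {w₂ = w₂} D₁ D₂ E _) u =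
  foldr (extendAll (E u) (candidates D₁) (candidates D₂)) [] (allFin w₁)

class-candidates : ∀ {S w} (D : Diagram S w) u → All (λ α → class D α ≡ u) (candidates D u)
class-candidates (leaf label L) u = atFalse
  where
  open IsLeafLabeling L
  atTrue : All (λ α → class (leaf label L) α ≡ u) (if ⟦ label u ⟧ true then (λ _ → true) ∷ [] else [])
  atTrue with ⟦ label u ⟧ true in eq
  ... | true  = exclusive true (proj₂ (complete true)) eq ∷ []
  ... | false = []
  atFalse : All (λ α → class (leaf label L) α ≡ u) (candidates (leaf label L) u)
  atFalse with ⟦ label u ⟧ false in eq
  ... | true  = exclusive false (proj₂ (complete false)) eq ∷ atTrue
  ... | false = atTrue
class-candidates {w = w} (node {w₁ = w₁} {w₂ = w₂} D₁ D₂ E E-P) u =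
  foldr-All _ [] outer [] (allFin w₁)
  where
  P : _ → Set
  P α = class (node D₁ D₂ E E-P) α ≡ u
  outer : ∀ v₁ r → All P r → All P (extendAll (E u) (candidates D₁) (candidates D₂) v₁ r)
  outer v₁ r pr with candidates D₁ v₁ | class-candidates D₁ v₁
  ... | []     | _         = pr
  ... | α₁ ∷ _ | refl ∷ _ = foldr-All _ r inner pr (allFin w₂)
    where
    inner : ∀ v₂ r′ → All P r′ → All P (extend (E u v₁) (candidates D₂) α₁ v₂ r′)
    inner v₂ r′ pr′ with E u v₁ v₂ in eq
    ... | false = pr′
    ... | true with candidates D₂ v₂ | class-candidates D₂ v₂
    ...   | []     | _        = pr′
    ...   | α₂ ∷ _ | refl ∷ _ = E-class E-P eq ∷ pr′

glue-∈-candidates :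
  ∀ {S₁ S₂ w w₁ w₂} .{{_ : NonZero w}} (D₁ : Diagram S₁ w₁) (D₂ : Diagram S₂ w₂)
  {E : Fin w → Fin w₁ → Fin w₂ → Bool} (E-P : IsPartition E) {u v₁ v₂ α₁ α₂ as₁ as₂} → E u v₁ v₂ ≡ true →
  candidates D₁ v₁ ≡ α₁ ∷ as₁ → candidates D₂ v₂ ≡ α₂ ∷ as₂ →
  glue α₁ α₂ ∈ candidates (node D₁ D₂ E E-P) u
glue-∈-candidates {w₁ = w₁} {w₂} D₁ D₂ {E} E-P {u} {v₁} {v₂} {α₁} {α₂} e eq₁ eq₂ =
  foldr-∈ _ [] outer-mono (∈-allFin v₁) outer-new
  where
  inner-mono : ∀ v₁ α₁ v₂ r′ {z} → z ∈ r′ → z ∈ extend (E u v₁) (candidates D₂) α₁ v₂ r′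
  inner-mono v₁ α₁ v₂ r′ z∈ with E u v₁ v₂
  ... | false = z∈
  ... | true with candidates D₂ v₂
  ...   | []     = z∈
  ...   | α₂ ∷ _ = there z∈
  outer-mono : ∀ v₁ r {z} → z ∈ r → z ∈ extendAll (E u) (candidates D₁) (candidates D₂) v₁ r
  outer-mono v₁ r z∈ with candidates D₁ v₁
  ... | []     = z∈
  ... | α₁ ∷ _ = foldr-⊇ _ r (inner-mono v₁ α₁) (allFin w₂) z∈
  outer-new : ∀ r → glue α₁ α₂ ∈ extendAll (E u) (candidates D₁) (candidates D₂) v₁ r
  outer-new r rewrite eq₁ = foldr-∈ _ r (inner-mono v₁ α₁) (∈-allFin v₂) inner-new
    where
    inner-new : ∀ r′ → glue α₁ α₂ ∈ extend (E u v₁) (candidates D₂) α₁ v₂ r′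
    inner-new r′ rewrite e | eq₂ = here refl

-- The representatives of the nodes reached by the two halves of `α` glue to a candidate. So every
-- node reached by some assignment has a representative to which that assignment can be compared.
candidates-nonempty : ∀ {S w} (D : Diagram S w) α →
                      ∃[ α₀ ] ∃[ αs ] candidates D (class D α) ≡ α₀ ∷ αs
candidates-nonempty (leaf label L) α with α here
... | false rewrite proj₂ (IsLeafLabeling.complete L false) = _ , _ , refl
... | true  with ⟦ label (proj₁ (IsLeafLabeling.complete L true)) ⟧ false
...   | true  = _ , _ , refl
...   | false rewrite proj₂ (IsLeafLabeling.complete L true) = _ , _ , refl
candidates-nonempty (node D₁ D₂ E E-P) α
  with α₁ , _ , eq₁ ← candidates-nonempty D₁ (α ∘ left)
  with α₂ , _ , eq₂ ← candidates-nonempty D₂ (α ∘ right)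
  with candidates (node D₁ D₂ E E-P) (class (node D₁ D₂ E E-P) α)
     | glue-∈-candidates D₁ D₂ E-P (proj₂ (IsPartition.covering E-P _ _)) eq₁ eq₂
... | _ ∷ _ | _ = _ , _ , refl

-- The tests along the first vtree

consistent : {A : Set} → (A → A → Bool) → List A → Bool
consistent test []       = true
consistent test (α ∷ αs) = all (test α) αs

localCheck checks :
  ∀ {n} (test : ∀ {S} → (Leaf S → Fin n) → (Leaf S → Bool) → (Leaf S → Bool) → Bool) →
  ∀ {S w} → (Leaf S → Fin n) → Diagram S w → Bool
localCheck test {w = w} b D = all (λ u → consistent (test b) (candidates D u)) (allFin w)
checks test b D@(leaf _ _)       = localCheck test b D
checks test b D@(node D₁ D₂ _ _) =
  checks test (b ∘ left) D₁ ∧ (checks test (b ∘ right) D₂ ∧ localCheck test b D)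

-- A congruence of Myhill-Nerode type: `α` and `α′` leave the same subfunction of `F`. Later `F` is
-- the root node of `D′` reached by an assignment.
Equivalent : ∀ {n} {A : Set} → ((Fin n → Bool) → A) →
             ∀ {S} → (Leaf S → Fin n) → (α α′ : Leaf S → Bool) → Set
Equivalent F b α α′ = ∀ a → F (patch b α a) ≡ F (patch b α′ a)

Respects : ∀ {n} {A : Set} → ((Fin n → Bool) → A) →
           ∀ {S w} → (Leaf S → Fin n) → Diagram S w → Set
Respects F b D = ∀ α α′ → class D α ≡ class D α′ → Equivalent F b α α′

module _ {n} {A : Set} (F : (Fin n → Bool) → A) (F-cong : ∀ {a a′} → a ≗ a′ → F a ≡ F a′)
         (test : ∀ {S} → (Leaf S → Fin n) → (Leaf S → Bool) → (Leaf S → Bool) → Bool) where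

  module _ (test⇒ : ∀ {S} (b : Leaf S → Fin n) → Injective _≡_ _≡_ b →
                      ∀ α α′ → test b α α′ ≡ true → Equivalent F b α α′) where

    local-sound : ∀ {S w} (b : Leaf S → Fin n) → Injective _≡_ _≡_ b → (D : Diagram S w) →
      localCheck test b D ≡ true → ∀ {u α₀ αs α} → candidates D u ≡ α₀ ∷ αs → α ∈ candidates D u →
      Equivalent F b α α₀
    local-sound b b-inj D ok {u} eq α∈
      with all-true⁻ (λ u → consistent (test b) (candidates D u)) ok (∈-allFin u)
    ... | c rewrite eq with α∈
    ...   | here refl = λ a → refl
    ...   | there α∈ = λ a → sym (test⇒ b b-inj _ _ (all-true⁻ _ c α∈) a)

    checks-sound : ∀ {S w} (b : Leaf S → Fin n) → Injective _≡_ _≡_ b → (D : Diagram S w) →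
      checks test b D ≡ true → ∀ α {α₀ αs} → candidates D (class D α) ≡ α₀ ∷ αs → Equivalent F b α α₀
    checks-sound b b-inj D@(leaf label L) ok α eq a =
      trans (F-cong (λ x → patch-ext x)) (local-sound b b-inj D ok eq (∈-candidates (α here)) a)
      where
      patch-ext : patch b α a ≗ patch b (λ _ → α here) a
      patch-ext x with leaf-of? leaf b x
      ... | yes (here , _) = refl
      ... | no _ = refl
      ∈-candidates : ∀ c → (λ _ → c) ∈ candidates D (proj₁ (IsLeafLabeling.complete L c))
      ∈-candidates false rewrite proj₂ (IsLeafLabeling.complete L false) = here refl
      ∈-candidates true with ⟦ label (proj₁ (IsLeafLabeling.complete L true)) ⟧ false
      ... | true  rewrite proj₂ (IsLeafLabeling.complete L true) = there (here refl)
      ... | false rewrite proj₂ (IsLeafLabeling.complete L true) = here refl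
    checks-sound b b-inj D@(node D₁ D₂ E E-P) ok α eq a
      with ok₁ , ok ← ∧-true⁻ (checks test (b ∘ left) D₁) ok
      with ok₂ , ok ← ∧-true⁻ (checks test (b ∘ right) D₂) ok
      with α₁ , _ , eq₁ ← candidates-nonempty D₁ (α ∘ left)
      with α₂ , _ , eq₂ ← candidates-nonempty D₂ (α ∘ right)
      = trans (F-cong (patch-node b b-inj α a))
       -- The right half of `α` has been absorbed into the assignment of the remaining variables, so
       -- the induction hypothesis for `D₁` applies. Switching from `patch-node` to `patch-node′`
       -- then absorbs `α₁` and exposes the right half.
       (trans (checks-sound (b ∘ left) (left-inj b b-inj) D₁ ok₁ (α ∘ left) eq₁ _)
       (trans (F-cong (λ x → sym (patch-node b b-inj (glue α₁ (α ∘ right)) a x)))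
       (trans (F-cong (patch-node′ b b-inj (glue α₁ (α ∘ right)) a))
       (trans (checks-sound (b ∘ right) (right-inj b b-inj) D₂ ok₂ (α ∘ right) eq₂ _)
       (trans (F-cong (λ x → sym (patch-node′ b b-inj (glue α₁ α₂) a x)))
              (local-sound b b-inj D ok eq
                (glue-∈-candidates D₁ D₂ E-P (proj₂ (IsPartition.covering E-P _ _)) eq₁ eq₂) a))))))

  module _ (test⇐ : ∀ {S} (b : Leaf S → Fin n) → Injective _≡_ _≡_ b →
                      ∀ α α′ → Equivalent F b α α′ → test b α α′ ≡ true) where

    local-complete : ∀ {S w} (b : Leaf S → Fin n) → Injective _≡_ _≡_ b → (D : Diagram S w) →
      Respects F b D → localCheck test b D ≡ true
    local-complete {w = w} b b-inj D resp = all-true⁺ _ {allFin w} (All.tabulate λ {u} _ → cons u)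
      where
      cons : ∀ u → consistent (test b) (candidates D u) ≡ true
      cons u with candidates D u | class-candidates D u
      ... | []    | _     = refl
      ... | α ∷ _ | p ∷ ps = all-true⁺ _ (All.map (λ q → test⇐ b b-inj _ _ (resp _ _ (trans p (sym q)))) ps)

    checks-complete : ∀ {S w} (b : Leaf S → Fin n) → Injective _≡_ _≡_ b → (D : Diagram S w) →
      Respects F b D → checks test b D ≡ true
    checks-complete b b-inj D@(leaf _ _) resp = local-complete b b-inj D resp
    checks-complete b b-inj D@(node D₁ D₂ E E-P) resp =
      ∧-true⁺ (checks-complete (b ∘ left) (left-inj b b-inj) D₁ resp₁)
        (∧-true⁺ (checks-complete (b ∘ right) (right-inj b b-inj) D₂ resp₂)
                 (local-complete b b-inj D resp))
      where
      -- The values at the other leaves are read off from a.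
      resp₁ : Respects F (b ∘ left) D₁
      resp₁ α α′ eq a =
        trans (F-cong (step α))
          (trans (resp (glue α (a ∘ b ∘ right)) (glue α′ (a ∘ b ∘ right))
                       (cong (λ v → proj₁ (IsPartition.covering E-P v _)) eq) a)
                 (F-cong (λ x → sym (step α′ x))))
        where
        step : ∀ α → patch (b ∘ left) α a ≗ patch b (glue α (a ∘ b ∘ right)) a
        step α x = trans (patch-cong (b ∘ left) α (λ y → sym (patch-self (b ∘ right) a y)) x)
                         (sym (patch-node b b-inj (glue α (a ∘ b ∘ right)) a x))
      resp₂ : Respects F (b ∘ right) D₂
      resp₂ α α′ eq a =
        trans (F-cong (step α))
          (trans (resp (glue (a ∘ b ∘ left) α) (glue (a ∘ b ∘ left) α′)
                       (cong (λ v → proj₁ (IsPartition.covering E-P _ v)) eq) a)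
                 (F-cong (λ x → sym (step α′ x))))
        where
        step : ∀ α → patch (b ∘ right) α a ≗ patch b (glue (a ∘ b ∘ left) α) a
        step α x = trans (patch-cong (b ∘ right) α (λ y → sym (patch-self (b ∘ left) a y)) x)
                         (sym (patch-node′ b b-inj (glue (a ∘ b ∘ left) α) a x))

-- The root of a Boolean TDD has two nodes, so two restrictions of D′ differ iff
-- an off-diagonal pair is reachable.
agree : ∀ {n S′} → Diagram S′ 2 → (Leaf S′ → Fin n) →
        ∀ {S} → (Leaf S → Fin n) → (α α′ : Leaf S → Bool) → Bool
agree D′ b′ b α α′ =
  not (reach D′ (linked b α α′ ∘ b′) 0F 1F) ∧ not (reach D′ (linked b α α′ ∘ b′) 1F 0F)

-- Correctness of the decision procedure

iff : Bool → Bool → Bool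
iff x y = if x then y else not y

iff⇔ : ∀ {P Q : Set} {x y} → (x ≡ true ⇔ P) → (y ≡ true ⇔ Q) → iff x y ≡ true ⇔ (P ⇔ Q)
iff⇔ {x = true}  {true}  p q = mk⇔ (λ _ → mk⇔ (λ _ → Equivalence.to q refl) (λ _ → Equivalence.to p refl)) (λ _ → refl)
iff⇔ {x = true}  {false} p q = mk⇔ (λ ()) λ e → Equivalence.from q (Equivalence.to e (Equivalence.to p refl))
iff⇔ {x = false} {true}  p q = mk⇔ (λ ()) λ e → Equivalence.from p (Equivalence.from e (Equivalence.to q refl))
iff⇔ {x = false} {false} p q = mk⇔
  (λ _ → mk⇔ (λ x → contradiction (Equivalence.from p x) λ ()) (λ y → contradiction (Equivalence.from q y) λ ()))
  (λ _ → refl)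

-- Evaluation of `D′` is expressed through `reach`: if `b` is onto, `linked b α α` allows a single
-- pair of equal values for each variable, and the pair `o′`, `o′` is reachable iff `D′` sends `α`
-- to `o′`. A root node without candidates is reached by no assignment and passes.
rootCheck : ∀ {n S S′} → (Leaf S → Fin n) → List (Leaf S → Bool) → Bool →
            Diagram S′ 2 → (Leaf S′ → Fin n) → Fin 2 → Bool
rootCheck b αs e D′ b′ o′ =
  withHead αs true λ α → iff (reach D′ (linked b α α ∘ b′) o′ o′) e

decide : ∀ {n S S′} → Diagram S 2 → (Leaf S → Fin n) → Fin 2 →
         Diagram S′ 2 → (Leaf S′ → Fin n) → Fin 2 → Bool
decide D b o D′ b′ o′ =
  checks (agree D′ b′) b D ∧
  (rootCheck b (candidates D 0F) (does (0F ≟ o)) D′ b′ o′ ∧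
   rootCheck b (candidates D 1F) (does (1F ≟ o)) D′ b′ o′)

does⇔ : ∀ {P : Set} (d : Dec P) → does d ≡ true ⇔ P
does⇔ (yes p) = mk⇔ (λ _ → p) (λ _ → refl)
does⇔ (no ¬p) = mk⇔ (λ ()) (λ p → contradiction p ¬p)

module _ {n S′} (D′ : Diagram S′ 2) (b′ : Leaf S′ → Fin n) (leafOf : Fin n → Leaf S′)
         (b′-leafOf : ∀ x → b′ (leafOf x) ≡ x) (leafOf-b′ : ∀ l → leafOf (b′ l) ≡ l) where

  private
    F : (Fin n → Bool) → Fin 2
    F a = class D′ (a ∘ b′)

    F-cong : ∀ {a a′} → a ≗ a′ → F a ≡ F a′
    F-cong eq = class-cong D′ (eq ∘ b′)

  -- `reach⁻` delivers values at the leaves of `D′`; the inverse `leafOf` of the leaf labeling turns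
  -- them into values of the variables, which `D` can read as well.
  reach-F⁻ : ∀ {V : Fin n → List (Bool × Bool)} {u u′} → reach D′ (V ∘ b′) u u′ ≡ true →
             ∃[ a ] ∃[ a′ ] Linked V a a′ × F a ≡ u × F a′ ≡ u′
  reach-F⁻ {V} eq with α , α′ , p , q , q′ ← reach⁻ D′ eq =
    α ∘ leafOf , α′ ∘ leafOf ,
    (λ x → subst (λ y → (α (leafOf x) , α′ (leafOf x)) ∈ V y) (b′-leafOf x) (p (leafOf x))) ,
    trans (class-cong D′ (cong α ∘ leafOf-b′)) q ,
    trans (class-cong D′ (cong α′ ∘ leafOf-b′)) q′

  agree⇒ : ∀ {S} (b : Leaf S → Fin n) → Injective _≡_ _≡_ b → ∀ α α′ →
           agree D′ b′ b α α′ ≡ true → Equivalent F b α α′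
  agree⇒ b b-inj α α′ ok a
    with F (patch b α a) | F (patch b α′ a) | reach⁺ D′ (patch-linked b b-inj α α′ a ∘ b′)
  ... | 0F | 0F | _ = refl
  ... | 1F | 1F | _ = refl
  ... | 0F | 1F | r rewrite r = contradiction ok λ ()
  ... | 1F | 0F | r with not (reach D′ (linked b α α′ ∘ b′) 0F 1F)
  ...   | true rewrite r = contradiction ok λ ()

  agree⇐ : ∀ {S} (b : Leaf S → Fin n) → Injective _≡_ _≡_ b → ∀ α α′ →
           Equivalent F b α α′ → agree D′ b′ b α α′ ≡ true
  agree⇐ b b-inj α α′ eqv = ∧-true⁺ (off 0F 1F λ ()) (off 1F 0F λ ())
    where
    off : ∀ u u′ → u ≢ u′ → not (reach D′ (linked b α α′ ∘ b′) u u′) ≡ true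
    off u u′ u≢u′ with reach D′ (linked b α α′ ∘ b′) u u′ in r
    ... | false = refl
    ... | true with a , a′ , p , refl , refl ← reach-F⁻ {linked b α α′} r
               with p₁ , p₂ ← linked-patch b b-inj α α′ p =
      contradiction (trans (sym (F-cong p₁)) (trans (eqv a) (F-cong p₂))) u≢u′

  module _ {S} (D : Diagram S 2) (b : Leaf S → Fin n) (b-inj : Injective _≡_ _≡_ b)
           (leafOf₁ : Fin n → Leaf S) (b-leafOf₁ : ∀ x → b (leafOf₁ x) ≡ x) (o o′ : Fin 2) where

    -- As `b` is onto, `α` fixes every variable and `patch b α a` does not depend on `a`. So the
    -- assignment found by `reach-F⁻` can be exchanged for the given one.
    accepts⇔ : ∀ α a → reach D′ (linked b α α ∘ b′) o′ o′ ≡ true ⇔ F (patch b α a) ≡ o′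
    accepts⇔ α a = mk⇔ to from
      where
      to : reach D′ (linked b α α ∘ b′) o′ o′ ≡ true → F (patch b α a) ≡ o′
      to r with a′ , _ , p , q , _ ← reach-F⁻ {linked b α α} r
           with p₁ , _ ← linked-patch b b-inj α α p =
        trans (F-cong (λ x → trans (patch-total x) (p₁ x))) q
        where
        patch-total : patch b α a ≗ patch b α a′
        patch-total x with leaf-of? S b x
        ... | yes _ = refl
        ... | no ∉  = contradiction (leafOf₁ x , b-leafOf₁ x) ∉
      from : F (patch b α a) ≡ o′ → reach D′ (linked b α α ∘ b′) o′ o′ ≡ true
      from refl = reach⁺ D′ (patch-linked b b-inj α α a ∘ b′)

    agrees⇔ : ∀ α a u → iff (reach D′ (linked b α α ∘ b′) o′ o′) (does (u ≟ o)) ≡ true ⇔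
                        (F (patch b α a) ≡ o′ ⇔ u ≡ o)
    agrees⇔ α a u = iff⇔ (accepts⇔ α a) (does⇔ (u ≟ o))

    decide⇔ : decide D b o D′ b′ o′ ≡ true ⇔ (∀ a → eval D (a ∘ b) o ≡ eval D′ (a ∘ b′) o′)
    decide⇔ = mk⇔ sound complete
      where
      sound : decide D b o D′ b′ o′ ≡ true → ∀ a → eval D (a ∘ b) o ≡ eval D′ (a ∘ b′) o′
      sound ok a
        with ok , ok-root ← ∧-true⁻ (checks (agree D′ b′) b D) ok
        with ok₀ , ok₁ ← ∧-true⁻ (rootCheck b (candidates D 0F) (does (0F ≟ o)) D′ b′ o′) ok-root
        with α₀ , αs , eq ← candidates-nonempty D (a ∘ b)
        = ⇔→≡ (mk⇔
          (λ e → Equivalence.from (eval⇔class D′ _ o′)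
                   (trans F≡ (Equivalence.from root (Equivalence.to (eval⇔class D _ o) e))))
          (λ e → Equivalence.from (eval⇔class D _ o)
                   (Equivalence.to root (trans (sym F≡) (Equivalence.to (eval⇔class D′ _ o′) e)))))
        where
        F≡ : F a ≡ F (patch b α₀ a)
        F≡ = trans (F-cong (λ x → sym (patch-self b a x)))
                   (checks-sound F F-cong (agree D′ b′) agree⇒ b b-inj D ok (a ∘ b) eq a)
        rootOk : ∀ u → rootCheck b (candidates D u) (does (u ≟ o)) D′ b′ o′ ≡ true
        rootOk 0F = ok₀
        rootOk 1F = ok₁
        root : F (patch b α₀ a) ≡ o′ ⇔ class D (a ∘ b) ≡ o
        root = Equivalence.to (agrees⇔ α₀ a (class D (a ∘ b)))
          (subst (λ αs → rootCheck b αs (does (class D (a ∘ b) ≟ o)) D′ b′ o′ ≡ true) eq (rootOk _))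

      complete : (∀ a → eval D (a ∘ b) o ≡ eval D′ (a ∘ b′) o′) → decide D b o D′ b′ o′ ≡ true
      complete eqv = ∧-true⁺ (checks-complete F F-cong (agree D′ b′) agree⇐ b b-inj D respects)
                             (∧-true⁺ (rootOk 0F) (rootOk 1F))
        where
        F⇔ : ∀ α a → F (patch b α a) ≡ o′ ⇔ class D α ≡ o
        F⇔ α a = mk⇔
          (λ e → trans (sym class≡) (Equivalence.to (eval⇔class D _ o)
                   (trans (eqv (patch b α a)) (Equivalence.from (eval⇔class D′ _ o′) e))))
          (λ e → Equivalence.to (eval⇔class D′ _ o′)
                   (trans (sym (eqv (patch b α a))) (Equivalence.from (eval⇔class D _ o) (trans class≡ e))))
          where
          class≡ : class D (patch b α a ∘ b) ≡ class D α
          class≡ = class-cong D (patch-in b b-inj α a)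
        respects : Respects F b D
        -- `F⇔` only controls whether `F` takes the value `o′`; among two root nodes this determines
        -- the value.
        respects α α′ eq a = Fin2-ext
          (λ e → Equivalence.from (F⇔ α′ a) (trans (sym eq) (Equivalence.to (F⇔ α a) e)))
          (λ e → Equivalence.from (F⇔ α a) (trans eq (Equivalence.to (F⇔ α′ a) e)))
          where
          Fin2-ext : ∀ {p q r : Fin 2} → (p ≡ r → q ≡ r) → (q ≡ r → p ≡ r) → p ≡ q
          Fin2-ext {0F} {0F}      f g = refl
          Fin2-ext {1F} {1F}      f g = refl
          Fin2-ext {0F} {1F} {0F} f g = sym (f refl)
          Fin2-ext {0F} {1F} {1F} f g = g refl
          Fin2-ext {1F} {0F} {0F} f g = g refl
          Fin2-ext {1F} {0F} {1F} f g = sym (f refl)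
        rootOk : ∀ u → rootCheck b (candidates D u) (does (u ≟ o)) D′ b′ o′ ≡ true
        rootOk u with candidates D u | class-candidates D u
        ... | []    | _        = refl
        -- The constant assignment is a dummy, as `α` already fixes every variable.
        ... | α ∷ _ | refl ∷ _ = Equivalence.from (agrees⇔ α (λ _ → false) (class D α)) (F⇔ α _)

-- The program

-- All functions take five arguments, of which the unused ones are nil, so that
-- the recursion schemes below can call a function that is only a variable.
arity : Fin 22 → ℕ
arity _ = 5

Ex : ℕ → Set
Ex = Exp arity

v : ∀ i {k} {i<k : True (i <? k)} → Ex k
v i {i<k = i<k} = var (#_ i {m<n = i<k})

`true : ∀ {k} → Ex k
`true = nil ∙ nil

-- A right fold over the two lists in the first two arguments, in lockstep.
-- The step is evaluated in the environment
-- r ∷ y ∷ ys ∷ x ∷ xs ∷ (x ∙ xs) ∷ (y ∙ ys) ∷ p₁ ∷ p₂ ∷ p₃, where r is the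
-- result of the recursive call.
loop : Fin 22 → Ex 5 → Ex 10 → Ex 5
loop f base step =
  match (v 0) base (match (v 3) nil
    (let′ (call f (v 3 ∷ v 1 ∷ v 6 ∷ v 7 ∷ v 8 ∷ [])) step))

mapLoop anyLoop allLoop : Fin 22 → Ex 10 → Ex 5
mapLoop f step = loop f nil (step ∙ v 0)
anyLoop f step = loop f nil (match step (v 0) `true)
allLoop f step = loop f `true (match step nil (v 2))

-- The environment starts with x ∷ labels for leafE and with r₂ ∷ r₁ ∷ d₂ ∷ E for
-- nodeE; the parameters p₁, …, p₄ come last.
treeRec : Fin 22 → Ex 9 → Ex 15 → Ex 5
treeRec f leafE nodeE =
  match (v 0) nil (match (v 0)
    (match (v 1) nil leafE)
    (match (v 3) nil (match (v 1) nil
      (let′ (call f (v 2 ∷ v 9 ∷ v 10 ∷ v 11 ∷ v 12 ∷ []))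
      (let′ (call f (v 1 ∷ v 10 ∷ v 11 ∷ v 12 ∷ v 13 ∷ [])) nodeE)))))

eqF linkedF leafAnyF leafRowF leafMatF any₂′F any₂F any₁′F any₁F nodeRowF nodeMatF reachF
  appendF leafCandF innerF outerF nodeCandF agreeF consistentF localF processF rootF : Fin 22
eqF         = # 0
linkedF     = # 1
leafAnyF    = # 2
leafRowF    = # 3
leafMatF    = # 4
any₂′F      = # 5
any₂F       = # 6
any₁′F      = # 7
any₁F       = # 8
nodeRowF    = # 9
nodeMatF    = # 10
reachF      = # 11
appendF     = # 12
leafCandF   = # 13
innerF      = # 14
outerF      = # 15
nodeCandF   = # 16
agreeF      = # 17
consistentF = # 18
localF      = # 19
processF    = # 20
rootF       = # 21

-- Applies the label at `l` to the value at `c`: a label is encoded by its truth table, whose two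
-- entries are `v 0` and `v 3` in the respective branches.
select : ∀ {k} → Fin k → Fin k → Ex k
select l c = match (var l) nil (match (var (suc (suc c))) (v 0) (v 3))

atTrueE : ∀ {k} → Fin k → Fin k → Ex k
atTrueE t x = match (var t) nil (((var (suc (suc x)) ∙ `true) ∙ nil) ∙ nil)

eqE agreeE rootE : Ex 5
eqE =
  match (v 0) (match (v 1) `true nil)
    (match (v 3) nil (call eqF (v 3 ∷ v 1 ∷ nil ∷ nil ∷ nil ∷ [])))
agreeE =
  match (call reachF (v 2 ∷ v 0 ∷ v 1 ∷ nil ∷ nil ∷ [])) nil (match (v 0) nil (match (v 1) nil
    (match (v 0) (match (v 5) nil (match (v 0) nil (match (v 0) `true nil))) nil)))
rootE =
  match (v 0) `true (let′
    (match (call reachF (v 5 ∷ v 0 ∷ v 0 ∷ nil ∷ nil ∷ [])) nil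
      (match (v 6) (match (v 0) nil (v 0))
        (match (v 3) nil (match (v 0) nil (match (v 1) nil (v 0))))))
    (match (v 0) (match (v 4) `true nil) (v 6)))

-- The order is that of the indices above. Loops that need only one list receive it twice, and many
-- of the `nil` branches merely catch ill-formed inputs.
bodies : Vec (Ex 5) 22
bodies =
  eqE ∷
  loop linkedF ((nil ∙ nil) ∙ (`true ∙ `true) ∙ nil)
    (match (v 3) nil (match (v 3) nil
      (match (call eqF (v 11 ∷ v 2 ∷ nil ∷ nil ∷ nil ∷ [])) (v 4) ((v 5 ∙ v 3) ∙ nil)))) ∷
  anyLoop leafAnyF (match (v 3) nil (match (select (# 9) (# 0)) nil (select (# 12) (# 3)))) ∷
  mapLoop leafRowF (call leafAnyF (v 8 ∷ v 8 ∷ v 7 ∷ v 3 ∷ nil ∷ [])) ∷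
  mapLoop leafMatF (call leafRowF (v 7 ∷ v 7 ∷ v 3 ∷ v 8 ∷ nil ∷ [])) ∷
  anyLoop any₂′F (match (v 1) nil (v 5)) ∷
  anyLoop any₂F (match (v 3) nil (call any₂′F (v 9 ∷ v 3 ∷ nil ∷ nil ∷ nil ∷ []))) ∷
  anyLoop any₁′F (match (v 1) nil (call any₂F (v 9 ∷ v 10 ∷ v 5 ∷ nil ∷ nil ∷ []))) ∷
  anyLoop any₁F (call any₁′F (v 7 ∷ v 1 ∷ v 3 ∷ v 8 ∷ nil ∷ [])) ∷
  mapLoop nodeRowF (call any₁F (v 7 ∷ v 8 ∷ v 3 ∷ v 9 ∷ nil ∷ [])) ∷
  mapLoop nodeMatF (call nodeRowF (v 7 ∷ v 7 ∷ v 3 ∷ v 8 ∷ v 9 ∷ [])) ∷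
  treeRec reachF
    (call leafMatF (v 1 ∷ v 1 ∷ v 1 ∷ call linkedF (v 5 ∷ v 6 ∷ v 0 ∷ nil ∷ nil ∷ []) ∷ nil ∷ []))
    (call nodeMatF (v 3 ∷ v 3 ∷ v 3 ∷ v 1 ∷ v 0 ∷ [])) ∷
  loop appendF (v 2) (v 3 ∙ v 0) ∷
  mapLoop leafCandF (match (v 3) nil (match (v 0) (atTrueE (# 1) (# 9))
    (((v 11 ∙ nil) ∙ nil) ∙ atTrueE (# 3) (# 11)))) ∷
  loop innerF (v 3) (match (v 3) (v 0) (match (v 3) (v 2)
    (call appendF (v 11 ∷ v 11 ∷ v 0 ∷ nil ∷ nil ∷ []) ∙ v 4))) ∷
  loop outerF nil (match (v 1) (v 0) (call innerF (v 5 ∷ v 9 ∷ v 0 ∷ v 2 ∷ nil ∷ []))) ∷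
  mapLoop nodeCandF (call outerF (v 3 ∷ v 7 ∷ v 8 ∷ nil ∷ nil ∷ [])) ∷
  agreeE ∷
  allLoop consistentF (call agreeF (v 7 ∷ v 3 ∷ v 8 ∷ nil ∷ nil ∷ [])) ∷
  allLoop localF (match (v 3) `true (call consistentF (v 1 ∷ v 1 ∷ v 0 ∷ v 9 ∷ nil ∷ []))) ∷
  -- One traversal of `D` returns the conjunction of all checks so far paired with the candidates,
  -- which the parent vertex needs for its gluings.
  treeRec processF
    (let′ (call leafCandF (v 1 ∷ v 1 ∷ v 0 ∷ nil ∷ nil ∷ []))
      (call localF (v 0 ∷ v 0 ∷ v 6 ∷ nil ∷ nil ∷ []) ∙ v 0))
    (match (v 1) nil (match (v 2) nil
      (let′ (call nodeCandF (v 7 ∷ v 7 ∷ v 3 ∷ v 1 ∷ nil ∷ []))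
        (match (v 3) nil (match (v 3) nil
          (call localF (v 4 ∷ v 4 ∷ v 20 ∷ nil ∷ nil ∷ []))) ∙ v 0)))) ∷
  rootE ∷
  []

body : (f : Fin 22) → Ex 5
body = lookup bodies

mainE : Ex 1
mainE =
  match (v 0) nil (match (v 0) nil (match (v 1) nil (match (v 5) nil (match (v 1) nil
  (match (call processF (v 5 ∷ v 1 ∷ nil ∷ nil ∷ nil ∷ [])) nil (match (v 1) nil (match (v 1) nil
  (match (v 4) nil
    -- In unary, an output node in `Fin 2` is also the Boolean `does (1F ≟ o)`. Its negation, here,
    -- is `does (0F ≟ o)`; the second call passes it unchanged.
    (match (call rootF (v 4 ∷ match (v 12) `true nil ∷ v 8 ∷ v 9 ∷ nil ∷ [])) nil
      (call rootF (v 4 ∷ v 14 ∷ v 10 ∷ v 11 ∷ nil ∷ [])))))))))))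

program : Program
program = record { arity = arity ; body = body ; main = mainE }

open Evaluation body

-- Polynomial cost bounds

infixr 6 _⊕_
infixr 7 _⊗_

-- Polynomials are syntax, so that unification can solve for them and `Poly-bound` can recurse over
-- the solution.
data Poly : Set where
  con     : ℕ → Poly
  size    : Poly
  _⊕_ _⊗_ : Poly → Poly → Poly

⟪_⟫ : Poly → ℕ → ℕ
⟪ con c ⟫ N = c
⟪ size ⟫ N  = N
⟪ p ⊕ q ⟫ N = ⟪ p ⟫ N + ⟪ q ⟫ N
⟪ p ⊗ q ⟫ N = ⟪ p ⟫ N * ⟪ q ⟫ N

-- The values of the cost polynomials p are never written out: in the lemmas
-- ∃[ p ] ∀ … they are inferred from the derivation.
record W {k} (N : ℕ) (ρ : Vec Tree k) (e : Ex k) (t : Tree) (p : Poly) : Set where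
  constructor within
  field
    {cost}     : ℕ
    derivation : ρ ⊢ e ⇓ t cost cost
    bound      : cost ≤ ⟪ p ⟫ N

record W* {k l} (N : ℕ) (ρ : Vec Tree k) (es : Vec (Ex k) l) (ts : Vec Tree l) (p : Poly) : Set where
  constructor within
  field
    {cost}     : ℕ
    derivation : ρ ⊢ es ⇓* ts cost cost
    bound      : cost ≤ ⟪ p ⟫ N

-- A wrapper keeping f visible to unification, which body f would not.
record Run (N : ℕ) (f : Fin 22) (args : Vec Tree 5) (t : Tree) (p : Poly) : Set where
  constructor run
  field
    body-W : W N args (body f) t p

Run-≡ : ∀ {N f args t t′ p} → t ≡ t′ → Run N f args t p → Run N f args t′ p
Run-≡ refl r = r

module _ {N k : ℕ} {ρ : Vec Tree k} where

  varʷ≡ : ∀ {i t} → lookup ρ i ≡ t → W N ρ (var i) t (con 1)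
  varʷ≡ refl = within (var _) ≤-refl

  varʷ : ∀ {i} → W N ρ (var i) (lookup ρ i) (con 1)
  varʷ = within (var _) ≤-refl

  nilʷ : W N ρ nil nil (con 1)
  nilʷ = within nil ≤-refl

  infixr 5 _∙ʷ_ _∷ʷ_

  _∙ʷ_ : ∀ {e₁ e₂ t₁ t₂ p q} → W N ρ e₁ t₁ p → W N ρ e₂ t₂ q →
         W N ρ (e₁ ∙ e₂) (t₁ ∙ t₂) (con 1 ⊕ (p ⊕ q))
  within d b ∙ʷ within d′ b′ = within (d ∙ d′) (s≤s (+-mono-≤ b b′))

  letʷ : ∀ {e₁ e₂ t₁ t₂ p q} → W N ρ e₁ t₁ p → W N (t₁ ∷ ρ) e₂ t₂ q →
         W N ρ (let′ e₁ e₂) t₂ (con 1 ⊕ (p ⊕ q))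
  letʷ (within d b) (within d′ b′) = within (let′ d d′) (s≤s (+-mono-≤ b b′))

  match∙ʷ : ∀ {e e₀ e₁ t₁ t₂ t p q} → W N ρ e (t₁ ∙ t₂) p → W N (t₁ ∷ t₂ ∷ ρ) e₁ t q →
            W N ρ (match e e₀ e₁) t (con 1 ⊕ (p ⊕ q))
  match∙ʷ (within d b) (within d′ b′) = within (match-∙ d d′) (s≤s (+-mono-≤ b b′))

  matchnilʷ : ∀ {e e₀ e₁ t p q} → W N ρ e nil p → W N ρ e₀ t q →
              W N ρ (match e e₀ e₁) t (con 1 ⊕ (p ⊕ q))
  matchnilʷ (within d b) (within d′ b′) = within (match-nil d d′) (s≤s (+-mono-≤ b b′))

  []ʷ : W* N ρ [] [] (con 0)
  []ʷ = within [] z≤n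

  _∷ʷ_ : ∀ {l e t p q} {es : Vec (Ex k) l} {ts} → W N ρ e t p → W* N ρ es ts q →
         W* N ρ (e ∷ es) (t ∷ ts) (p ⊕ q)
  within d b ∷ʷ within d′ b′ = within (d ∷ d′) (+-mono-≤ b b′)

  callʷ : ∀ {f es ts t p q} → W* N ρ es ts p → Run N f ts t q →
          W N ρ (call f es) t (con 1 ⊕ (p ⊕ q))
  callʷ (within d b) (run (within d′ b′)) = within (call d d′) (s≤s (+-mono-≤ b b′))

  weaken : ∀ {e t p} q → W N ρ e t p → ⟪ p ⟫ N ≤ ⟪ q ⟫ N → W N ρ e t q
  weaken q (within d b) p≤q = within d (≤-trans b p≤q)

  trueʷ : W N ρ `true (encodeBool true) (con 3)
  trueʷ = within (nil ∙ nil) ≤-refl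

  module _ {A : Set} (enc : A → Tree) {e e₀ : Ex k} {e₁ : Ex (2 + k)} {p q r : Poly} where

    private
      -- The branches contribute their sum, which bounds either of them and makes the polynomial
      -- independent of the value that is inspected.
      s : Poly
      s = con 1 ⊕ (p ⊕ (q ⊕ r))

    ifʷ : ∀ {b x y} → W N ρ e (encodeBool b) p →
          W N ρ e₀ (enc y) q → W N (nil ∷ nil ∷ ρ) e₁ (enc x) r →
          W N ρ (match e e₀ e₁) (enc (if b then x else y)) s
    ifʷ {false} c w₀ w₁ = weaken s (matchnilʷ c w₀) (s≤s (+-monoʳ-≤ (⟪ p ⟫ N) (m≤m+n _ _)))
    ifʷ {true}  c w₀ w₁ = weaken s (match∙ʷ c w₁) (s≤s (+-monoʳ-≤ (⟪ p ⟫ N) (m≤n+m _ _)))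

    headʷ : ∀ {I : Set} {X : I → Tree} {is z f} → W N ρ e (encodeList X is) p →
            W N ρ e₀ (enc z) q →
            (∀ i is → W N (X i ∷ encodeList X is ∷ ρ) e₁ (enc (f i)) r) →
            W N ρ (match e e₀ e₁) (enc (withHead is z f)) s
    headʷ {is = []}    c w₀ w₁ = weaken s (matchnilʷ c w₀) (s≤s (+-monoʳ-≤ (⟪ p ⟫ N) (m≤m+n _ _)))
    headʷ {is = _ ∷ _} c w₀ w₁ = weaken s (match∙ʷ c (w₁ _ _)) (s≤s (+-monoʳ-≤ (⟪ p ⟫ N) (m≤n+m _ _)))

  andʷ : ∀ {e e₁ a b p q} → W N ρ e (encodeBool a) p → W N (nil ∷ nil ∷ ρ) e₁ (encodeBool b) q →
         W N ρ (match e nil e₁) (encodeBool (a ∧ b)) (con 1 ⊕ (p ⊕ (con 1 ⊕ q)))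
  andʷ {a = false} w w₁ = ifʷ encodeBool {b = false} w nilʷ w₁
  andʷ {a = true}  w w₁ = ifʷ encodeBool {b = true} {y = false} w nilʷ w₁

  orʷ : ∀ {e e₀ a b p q} → W N ρ e (encodeBool a) p → W N ρ e₀ (encodeBool b) q →
        W N ρ (match e e₀ `true) (encodeBool (a ∨ b)) (con 1 ⊕ (p ⊕ (q ⊕ con 3)))
  orʷ {a = false} w w₀ = ifʷ encodeBool {b = false} {x = true} w w₀ (within (nil ∙ nil) ≤-refl)
  orʷ {a = true}  w w₀ = ifʷ encodeBool {b = true} w w₀ (within (nil ∙ nil) ≤-refl)

-- Loops

-- An iteration costs 11 besides its step: two matches on variables (4), the `let′` (1) and the call
-- with five arguments (6). The final match on `nil` costs 2 besides the base.
loopᵖ : Poly → Poly → Poly → Poly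
loopᵖ q b s = (q ⊗ (con 11 ⊕ s)) ⊕ (con 2 ⊕ b)

loop-arith : ∀ L B C → 11 + ((L * (11 + C) + (2 + B)) + C) ≡ ((11 + C) + L * (11 + C)) + (2 + B)
loop-arith = solve-∀

foldr-∙ : ∀ {A : Set} (Z : A → Tree) xs → foldr (λ x r → Z x ∙ r) nil xs ≡ encodeList Z xs
foldr-∙ Z []       = refl
foldr-∙ Z (x ∷ xs) = cong (Z x ∙_) (foldr-∙ Z xs)

foldr-any : ∀ {A : Set} (p : A → Bool) xs → foldr (λ x r → p x ∨ r) false xs ≡ any p xs
foldr-any p []       = refl
foldr-any p (x ∷ xs) = cong (p x ∨_) (foldr-any p xs)

foldr-all : ∀ {A : Set} (p : A → Bool) xs → foldr (λ x r → p x ∧ r) true xs ≡ all p xs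
foldr-all p []       = refl
foldr-all p (x ∷ xs) = cong (p x ∧_) (foldr-all p xs)

module _ {N : ℕ} {I : Set} {X Y : I → Tree} {p₁ p₂ p₃ : Tree} where

  module _ {A : Set} (enc : A → Tree) {f : Fin 22} {base : Ex 5} {step : Ex 10} (f-loop : body f ≡ loop f base step)
           {s : I → A → A} {z : A} {b c : Poly} (q : Poly)
           (base-W : ∀ xs ys → W N (xs ∷ ys ∷ p₁ ∷ p₂ ∷ p₃ ∷ []) base (enc z) b)
           (step-W : ∀ i r {t₁ t₂ t₃ t₄} →
              W N (enc r ∷ Y i ∷ t₁ ∷ X i ∷ t₂ ∷ t₃ ∷ t₄ ∷ p₁ ∷ p₂ ∷ p₃ ∷ []) step (enc (s i r)) c) where

    loopʷ : ∀ is → length is ≤ ⟪ q ⟫ N →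
            Run N f (encodeList X is ∷ encodeList Y is ∷ p₁ ∷ p₂ ∷ p₃ ∷ [])
                (enc (foldr s z is)) (loopᵖ q b c)
    loopʷ is is≤q = let _ , d , le = go is in
      run (within d (≤-trans le (+-monoˡ-≤ (2 + ⟪ b ⟫ N) (*-monoˡ-≤ (11 + ⟪ c ⟫ N) is≤q))))
      where
      K B : ℕ
      K = 11 + ⟪ c ⟫ N
      B = 2 + ⟪ b ⟫ N
      go : ∀ is → ∃[ t ] ((encodeList X is ∷ encodeList Y is ∷ p₁ ∷ p₂ ∷ p₃ ∷ []) ⊢ body f ⇓
                          enc (foldr s z is) cost t) × t ≤ length is * K + B
      go [] with within d le ← base-W nil nil =
        _ , subst (λ e → _ ⊢ e ⇓ _ cost _) (sym f-loop) (match-nil (var _) d) , s≤s (s≤s le)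
      go (i ∷ is) with t , d , le ← go is with within {t′} d′ le′ ← step-W i (foldr s z is) =
        11 + (t + t′) ,
        subst (λ e → _ ⊢ e ⇓ _ cost _) (sym f-loop)
          (match-∙ (var _) (match-∙ (var _)
            (let′ (call (var _ ∷ var _ ∷ var _ ∷ var _ ∷ var _ ∷ []) d) d′))) ,
        ≤-trans (+-monoʳ-≤ 11 (+-mono-≤ le le′)) (≤-reflexive (loop-arith (length is) (⟪ b ⟫ N) (⟪ c ⟫ N)))

  module _ {f : Fin 22} {step : Ex 10} {c : Poly} (q : Poly) where

    mapʷ : body f ≡ mapLoop f step → {Z : I → Tree} →
      (∀ i {r t₁ t₂ t₃ t₄} →
        W N (r ∷ Y i ∷ t₁ ∷ X i ∷ t₂ ∷ t₃ ∷ t₄ ∷ p₁ ∷ p₂ ∷ p₃ ∷ []) step (Z i) c) →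
      ∀ is → length is ≤ ⟪ q ⟫ N →
      Run N f (encodeList X is ∷ encodeList Y is ∷ p₁ ∷ p₂ ∷ p₃ ∷ []) (encodeList Z is)
          (loopᵖ q (con 1) (con 1 ⊕ (c ⊕ con 1)))
    mapʷ eq {Z} w is le = Run-≡ (foldr-∙ Z is)
      (loopʷ id eq q (λ _ _ → nilʷ) (λ i r → w i ∙ʷ varʷ) is le)

    module _ {P : I → Bool}
      (w : ∀ i {r t₁ t₂ t₃ t₄} →
        W N (r ∷ Y i ∷ t₁ ∷ X i ∷ t₂ ∷ t₃ ∷ t₄ ∷ p₁ ∷ p₂ ∷ p₃ ∷ []) step (encodeBool (P i)) c) where

      anyʷ : body f ≡ anyLoop f step → ∀ is → length is ≤ ⟪ q ⟫ N →
        Run N f (encodeList X is ∷ encodeList Y is ∷ p₁ ∷ p₂ ∷ p₃ ∷ []) (encodeBool (any P is))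
            (loopᵖ q (con 1) (con 1 ⊕ (c ⊕ (con 1 ⊕ con 3))))
      anyʷ eq is le = Run-≡ (cong encodeBool (foldr-any P is))
        (loopʷ encodeBool eq q (λ _ _ → nilʷ) (λ i r → orʷ {a = P i} {r} (w i) varʷ) is le)

      allʷ : body f ≡ allLoop f step → ∀ is → length is ≤ ⟪ q ⟫ N →
        Run N f (encodeList X is ∷ encodeList Y is ∷ p₁ ∷ p₂ ∷ p₃ ∷ []) (encodeBool (all P is))
            (loopᵖ q (con 3) (con 1 ⊕ (c ⊕ (con 1 ⊕ con 1))))
      allʷ eq is le = Run-≡ (cong encodeBool (foldr-all P is))
        (loopʷ encodeBool eq q (λ _ _ → trueʷ) (λ i r → andʷ {a = P i} {r} (w i) varʷ) is le)

-- Encodings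

fam : ∀ {w} → (Fin w → Tree) → Tree
fam {w} X = encodeList X (allFin w)

row : ∀ {w} → (Fin w → Bool) → Tree
row R = fam (λ u → encodeBool (R u))

mat : ∀ {w w′} → (Fin w → Fin w′ → Bool) → Tree
mat M = fam (λ u → row (M u))

length-allFin : ∀ {w N} → w ≤ N → length (allFin w) ≤ N
length-allFin {w} = subst (_≤ _) (sym (length-tabulate id))

-- Families are listed along `allFin` instead of by `tabulate`, because the loop lemmas are about
-- two encodings along one index list.
encodeDiagram′ : ∀ {n S w} → (Leaf S → Fin n) → Diagram S w → Tree
encodeDiagram′ b (leaf label _) =
  nil ∙ encodeFin (b here) ∙ fam (λ u → encodeLabel (label u))
encodeDiagram′ b (node D₁ D₂ E _) =
  (nil ∙ nil) ∙ encodeDiagram′ (b ∘ left) D₁ ∙ encodeDiagram′ (b ∘ right) D₂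
              ∙ fam (λ u → mat (E u))

assignment : ∀ {n S} → (Leaf S → Fin n) → (Leaf S → Bool) → Tree
assignment {S = S} b α = encodeList (λ l → encodeFin (b l) ∙ encodeBool (α l)) (leaves S)

encodeList-cong : ∀ {A : Set} {X Y : A → Tree} → X ≗ Y → encodeList X ≗ encodeList Y
encodeList-cong eq []       = refl
encodeList-cong eq (x ∷ xs) = cong₂ _∙_ (eq x) (encodeList-cong eq xs)

encodeList-map : ∀ {A B : Set} {X : B → Tree} (f : A → B) → encodeList X ∘ map f ≗ encodeList (X ∘ f)
encodeList-map f []       = refl
encodeList-map f (x ∷ xs) = cong (_ ∙_) (encodeList-map f xs)

encodeFamily≡ : ∀ {w} {A : Set} {enc : A → Tree} {X : Fin w → A} {Y} → enc ∘ X ≗ Y →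
                encodeFamily enc X ≡ fam Y
encodeFamily≡ {enc = enc} {X} eq =
  trans (cong (encodeList enc) (sym (map-tabulate id X)))
        (trans (encodeList-map X _) (encodeList-cong eq _))

encodeDiagram≡ : ∀ {n S w} (b : Leaf S → Fin n) (D : Diagram S w) →
                 encodeDiagram b D ≡ encodeDiagram′ b D
encodeDiagram≡ b (leaf label _) = cong (λ t → nil ∙ _ ∙ t) (encodeFamily≡ λ _ → refl)
encodeDiagram≡ b (node D₁ D₂ E _) =
  cong ((nil ∙ nil) ∙_) (cong₂ _∙_ (encodeDiagram≡ (b ∘ left) D₁)
    (cong₂ _∙_ (encodeDiagram≡ (b ∘ right) D₂)
      (encodeFamily≡ λ _ → encodeFamily≡ λ _ → encodeFamily≡ λ _ → refl)))

-- Recursion over diagrams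

treeRec-arith : ∀ A B c₁ c₂ →
  15 + (c₁ + (7 + (c₂ + B))) ≤ (22 + (A + B)) + (c₁ + c₂)
treeRec-arith A B c₁ c₂ = ≤-trans (m≤m+n _ A) (≤-reflexive (arith A B c₁ c₂))
  where
  arith : ∀ A B c₁ c₂ → 15 + (c₁ + (7 + (c₂ + B))) + A ≡ (22 + (A + B)) + (c₁ + c₂)
  arith = solve-∀

-- The overhead of an inner vertex is 22: four matches on variables (8) and two recursive calls
-- bound by `let′` (7 each). That of a leaf is only 6.
treeRecᵖ : Poly → Poly → Poly
treeRecᵖ p q = size ⊗ (con 22 ⊕ (p ⊕ q))

module _ {n N : ℕ} {f : Fin 22} {leafE : Ex 9} {nodeE : Ex 15}
  (f-rec : body f ≡ treeRec f leafE nodeE) {p₁ p₂ p₃ p₄ : Tree}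
  (Res : ∀ {S w} → (Leaf S → Fin n) → Diagram S w → Tree) {p q : Poly}
  (leaf-W : ∀ {w} .{{_ : NonZero w}} (b : Leaf leaf → Fin n) label (L : IsLeafLabeling {w} label) →
    w ≤ N → ∀ {t₁ t₂ t₃} →
    W N (encodeFin (b here) ∷ fam (λ u → encodeLabel (label u)) ∷ t₁ ∷ t₂ ∷ t₃ ∷ p₁ ∷ p₂ ∷ p₃ ∷ p₄ ∷ [])
        leafE (Res b (leaf label L)) p)
  (node-W : ∀ {S₁ S₂ w w₁ w₂} .{{_ : NonZero w}} (b : Leaf (node S₁ S₂) → Fin n)
    (D₁ : Diagram S₁ w₁) (D₂ : Diagram S₂ w₂) E (E-P : IsPartition {w} E) →
    ∣ node D₁ D₂ E E-P ∣ᴰ ≤ N → ∀ {t₁ t₂ t₃ t₄ t₅ t₆ t₇ t₈} →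
    W N (Res (b ∘ right) D₂ ∷ Res (b ∘ left) D₁ ∷ t₁ ∷ fam (λ u → mat (E u)) ∷
         t₂ ∷ t₃ ∷ t₄ ∷ t₅ ∷ t₆ ∷ t₇ ∷ t₈ ∷ p₁ ∷ p₂ ∷ p₃ ∷ p₄ ∷ [])
        nodeE (Res b (node D₁ D₂ E E-P)) q) where

  treeRecʷ : ∀ {S w} (b : Leaf S → Fin n) (D : Diagram S w) → ∣ D ∣ᴰ ≤ N →
             Run N f (encodeDiagram′ b D ∷ p₁ ∷ p₂ ∷ p₃ ∷ p₄ ∷ []) (Res b D) (treeRecᵖ p q)
  treeRecʷ b D D≤N = let _ , d , le = go b D D≤N in
    run (within d (≤-trans le (*-monoˡ-≤ K D≤N)))
    where
    K : ℕ
    K = 22 + (⟪ p ⟫ N + ⟪ q ⟫ N)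
    -- Every vertex carries at least one node, so a charge of `K` per vertex sums to at most `K`
    -- times the size.
    K≤ : ∀ w x .{{_ : NonZero w}} → K + x * K ≤ (w + x) * K
    K≤ (suc w) x = +-monoʳ-≤ K (*-monoˡ-≤ K (m≤n+m x w))
    go : ∀ {S w} (b : Leaf S → Fin n) (D : Diagram S w) → ∣ D ∣ᴰ ≤ N →
         ∃[ t ] ((encodeDiagram′ b D ∷ p₁ ∷ p₂ ∷ p₃ ∷ p₄ ∷ []) ⊢ body f ⇓ Res b D cost t) ×
                t ≤ ∣ D ∣ᴰ * K
    go b (leaf {w} label L) D≤N with within {c} d le ← leaf-W b label L D≤N =
      6 + c ,
      subst (λ e → _ ⊢ e ⇓ _ cost _) (sym f-rec)
        (match-∙ (var _) (match-nil (var _) (match-∙ (var _) d))) ,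
      ≤-trans (+-mono-≤ (m≤m+n 6 16) (≤-trans le (m≤m+n _ _)))
        (subst (λ x → K ≤ x * K) (+-identityʳ w) (≤-trans (m≤m+n K 0) (K≤ w 0)))
    go b D@(node {w = w} D₁ D₂ E E-P) D≤N
      with D₁₂≤N ← ≤-trans (m≤n+m _ w) D≤N
      with c₁ , d₁ , le₁ ← go (b ∘ left) D₁ (≤-trans (m≤m+n _ _) D₁₂≤N)
      with c₂ , d₂ , le₂ ← go (b ∘ right) D₂ (≤-trans (m≤n+m _ ∣ D₁ ∣ᴰ) D₁₂≤N)
      with within {c} d le ← node-W b D₁ D₂ E E-P D≤N =
      15 + (c₁ + (7 + (c₂ + c))) ,
      subst (λ e → _ ⊢ e ⇓ _ cost _) (sym f-rec)
        (match-∙ (var _) (match-∙ (var _) (match-∙ (var _) (match-∙ (var _)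
          (let′ (call (var _ ∷ var _ ∷ var _ ∷ var _ ∷ var _ ∷ []) d₁)
          (let′ (call (var _ ∷ var _ ∷ var _ ∷ var _ ∷ var _ ∷ []) d₂) d)))))) ,
      ≤-trans (+-monoʳ-≤ 15 (+-monoʳ-≤ c₁ (+-monoʳ-≤ 7 (+-monoʳ-≤ c₂ le))))
      (≤-trans (treeRec-arith (⟪ p ⟫ N) (⟪ q ⟫ N) c₁ c₂)
      (≤-trans (+-monoʳ-≤ K (≤-trans (+-mono-≤ le₁ le₂)
                                     (≤-reflexive (sym (*-distribʳ-+ K ∣ D₁ ∣ᴰ ∣ D₂ ∣ᴰ)))))
               (K≤ w (∣ D₁ ∣ᴰ + ∣ D₂ ∣ᴰ))))

-- The functions of the program

width≤size : ∀ {S w} (D : Diagram S w) → w ≤ ∣ D ∣ᴰ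
width≤size (leaf _ _)     = ≤-refl
width≤size (node _ _ _ _) = m≤m+n _ _

selectʷ : ∀ {N k} {ρ : Vec Tree k} l c ℓ x →
          lookup ρ l ≡ encodeLabel ℓ → lookup ρ c ≡ encodeBool x →
          W N ρ (select l c) (encodeBool (⟦ ℓ ⟧ x)) (con 5)
selectʷ l c ℓ false eq eq′ = weaken (con 5)
  (match∙ʷ (varʷ≡ eq)
    (matchnilʷ (varʷ≡ eq′) varʷ)) ≤-refl
selectʷ l c ℓ true eq eq′ = weaken (con 5)
  (match∙ʷ (varʷ≡ eq)
    (match∙ʷ (varʷ≡ eq′) varʷ)) ≤-refl

-- A recursive step costs 10 (two matches and a call with five arguments); the last one costs at
-- most 7 (two matches and building `true`).
eqʷ : ∀ {N} m k → m ≤ N →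
      Run N eqF (encodeℕ m ∷ encodeℕ k ∷ nil ∷ nil ∷ nil ∷ []) (encodeBool (m ≡ᵇ k))
          (size ⊗ con 10 ⊕ con 7)
eqʷ {N} m k m≤N = run (weaken _ (Run.body-W (go m k)) (+-monoˡ-≤ 7 (*-monoˡ-≤ 10 m≤N)))
  where
  go : ∀ m k → Run N eqF (encodeℕ m ∷ encodeℕ k ∷ nil ∷ nil ∷ nil ∷ [])
                   (encodeBool (m ≡ᵇ k)) (con (m * 10 + 7))
  go zero    zero    = run (weaken _ (matchnilʷ varʷ (matchnilʷ varʷ trueʷ)) ≤-refl)
  go zero    (suc k) = run (weaken _ (matchnilʷ varʷ (match∙ʷ varʷ nilʷ)) (m≤m+n 5 2))
  go (suc m) zero    = run (weaken _ (match∙ʷ varʷ (matchnilʷ varʷ nilʷ)) (m≤m+n 5 _))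
  go (suc m) (suc k) = run (weaken _
    (match∙ʷ varʷ (match∙ʷ varʷ (callʷ (varʷ ∷ʷ varʷ ∷ʷ nilʷ ∷ʷ nilʷ ∷ʷ nilʷ ∷ʷ []ʷ) (go m k))))
    ≤-refl)

encodePair : Bool × Bool → Tree
encodePair (x , y) = encodeBool x ∙ encodeBool y

linkedʷ : ∃[ p ] ∀ {n N} → n ≤ N → ∀ {S} (b : Leaf S → Fin n) α α′ → length (leaves S) ≤ N → ∀ x →
  Run N linkedF (assignment b α ∷ assignment b α′ ∷ encodeFin x ∷ nil ∷ nil ∷ [])
      (encodeList encodePair (linked b α α′ x)) p
linkedʷ = _ , λ n≤N {S} b α α′ le x →
  loopʷ (encodeList encodePair) refl size
    (λ _ _ → (nilʷ ∙ʷ nilʷ) ∙ʷ (trueʷ ∙ʷ trueʷ) ∙ʷ nilʷ)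
    (λ l r → match∙ʷ varʷ (match∙ʷ varʷ (ifʷ (encodeList encodePair) {b = toℕ x ≡ᵇ toℕ (b l)}
      (callʷ (varʷ ∷ʷ varʷ ∷ʷ nilʷ ∷ʷ nilʷ ∷ʷ nilʷ ∷ʷ []ʷ)
             (eqʷ (toℕ x) (toℕ (b l)) (≤-trans (<⇒≤ (toℕ<n x)) n≤N)))
      varʷ ((varʷ ∙ʷ varʷ) ∙ʷ nilʷ))))
    (leaves S) le

length-linked : ∀ {n S} (b : Leaf S → Fin n) α α′ x → length (linked b α α′ x) ≤ 2
length-linked {S = S} b α α′ x = go (leaves S)
  where
  go : ∀ ls → length (foldr (λ l r → if toℕ x ≡ᵇ toℕ (b l) then (α l , α′ l) ∷ [] else r)
                            ((false , false) ∷ (true , true) ∷ []) ls) ≤ 2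
  go []       = ≤-refl
  go (l ∷ ls) with toℕ x ≡ᵇ toℕ (b l)
  ... | true  = s≤s z≤n
  ... | false = go ls

leafAnyʷ : ∃[ p ] ∀ {N} V ℓ ℓ′ → length V ≤ 2 →
  Run N leafAnyF (encodeList encodePair V ∷ encodeList encodePair V ∷ encodeLabel ℓ ∷ encodeLabel ℓ′ ∷ nil ∷ []) (encodeBool (any (λ (x , x′) → ⟦ ℓ ⟧ x ∧ ⟦ ℓ′ ⟧ x′) V)) p
leafAnyʷ = _ , λ V ℓ ℓ′ le → anyʷ (con 2)
  (λ (x , x′) → match∙ʷ varʷ
    (andʷ (selectʷ (# 9) (# 0) ℓ x refl refl) (selectʷ (# 12) (# 3) ℓ′ x′ refl refl)))
  refl V le

leafRowʷ : ∃[ p ] ∀ {N w} (label : Fin w → Label) ℓ V → w ≤ N → length V ≤ 2 →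
  Run N leafRowF (fam (λ u → encodeLabel (label u)) ∷ fam (λ u → encodeLabel (label u)) ∷ encodeLabel ℓ ∷
       encodeList encodePair V ∷ nil ∷ []) (row (λ u → any (λ (x , x′) → ⟦ ℓ ⟧ x ∧ ⟦ label u ⟧ x′) V)) p
leafRowʷ = _ , λ label ℓ V w≤N le → mapʷ size refl
  (λ u → callʷ (varʷ ∷ʷ varʷ ∷ʷ varʷ ∷ʷ varʷ ∷ʷ nilʷ ∷ʷ []ʷ) (proj₂ leafAnyʷ V ℓ (label u) le))
  _ (length-allFin w≤N)

leafMatʷ : ∃[ p ] ∀ {N w} (label : Fin w → Label) V → w ≤ N → length V ≤ 2 →
  Run N leafMatF (fam (λ u → encodeLabel (label u)) ∷ fam (λ u → encodeLabel (label u)) ∷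
       fam (λ u → encodeLabel (label u)) ∷ encodeList encodePair V ∷ nil ∷ []) (mat (λ u u′ → any (λ (x , x′) → ⟦ label u ⟧ x ∧ ⟦ label u′ ⟧ x′) V)) p
leafMatʷ = _ , λ label V w≤N le → mapʷ size refl
  (λ u → callʷ (varʷ ∷ʷ varʷ ∷ʷ varʷ ∷ʷ varʷ ∷ʷ nilʷ ∷ʷ []ʷ) (proj₂ leafRowʷ label (label u) V w≤N le))
  _ (length-allFin w≤N)

any₂′ʷ : ∃[ p ] ∀ {N w} (R M : Fin w → Bool) → w ≤ N →
  Run N any₂′F (row R ∷ row M ∷ nil ∷ nil ∷ nil ∷ [])
      (encodeBool (any (λ v → M v ∧ R v) (allFin w))) p
any₂′ʷ = _ , λ R M w≤N → anyʷ size (λ v → andʷ {a = M v} {R v} varʷ varʷ) refl _ (length-allFin w≤N)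

any₂ʷ : ∃[ p ] ∀ {N w} (R R′ : Fin w → Bool) (M : Fin w → Fin w → Bool) → w ≤ N →
  Run N any₂F (row R ∷ mat M ∷ row R′ ∷ nil ∷ nil ∷ [])
      (encodeBool (any (λ v → R v ∧ any (λ v′ → M v v′ ∧ R′ v′) (allFin w)) (allFin w))) p
any₂ʷ = _ , λ {_} {w} R R′ M w≤N → anyʷ size
  (λ v → andʷ {a = R v} {any (λ v′ → M v v′ ∧ R′ v′) (allFin w)} varʷ
    (callʷ (varʷ ∷ʷ varʷ ∷ʷ nilʷ ∷ʷ nilʷ ∷ʷ nilʷ ∷ʷ []ʷ) (proj₂ any₂′ʷ R′ (M v) w≤N)))
  refl _ (length-allFin w≤N)

-- The condition of `reach` at an inner node for fixed `v₁` and `v₁′`. In this nesting the remaining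
-- loops need only the rows `R v₁` and `R′ v₁′` and the matrix `M₂`, so the program walks lists in
-- lockstep and never has to index into them.
meet : ∀ {w₁ w₂} (M₁ : Fin w₁ → Fin w₁ → Bool) (M₂ : Fin w₂ → Fin w₂ → Bool) →
       (R R′ : Fin w₁ → Fin w₂ → Bool) → Fin w₁ → Fin w₁ → Bool
meet {w₂ = w₂} M₁ M₂ R R′ v₁ v₁′ = M₁ v₁ v₁′ ∧
  any (λ v₂ → R v₁ v₂ ∧ any (λ v₂′ → M₂ v₂ v₂′ ∧ R′ v₁′ v₂′) (allFin w₂)) (allFin w₂)

any₁′ʷ : ∃[ p ] ∀ {N w₁ w₂} (M₁ : Fin w₁ → Fin w₁ → Bool) (M₂ : Fin w₂ → Fin w₂ → Bool) R R′ v₁ →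
  w₁ ≤ N → w₂ ≤ N →
  Run N any₁′F (mat R′ ∷ row (M₁ v₁) ∷ row (R v₁) ∷ mat M₂ ∷ nil ∷ [])
      (encodeBool (any (meet M₁ M₂ R R′ v₁) (allFin w₁))) p
any₁′ʷ = _ , λ {_} {_} {w₂} M₁ M₂ R R′ v₁ w₁≤N w₂≤N → anyʷ size
  (λ v₁′ → andʷ {a = M₁ v₁ v₁′}
      {any (λ v₂ → R v₁ v₂ ∧ any (λ v₂′ → M₂ v₂ v₂′ ∧ R′ v₁′ v₂′) (allFin w₂)) (allFin w₂)} varʷ
    (callʷ (varʷ ∷ʷ varʷ ∷ʷ varʷ ∷ʷ nilʷ ∷ʷ nilʷ ∷ʷ []ʷ) (proj₂ any₂ʷ (R v₁) (R′ v₁′) M₂ w₂≤N)))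
  refl _ (length-allFin w₁≤N)

any₁ʷ : ∃[ p ] ∀ {N w₁ w₂} (M₁ : Fin w₁ → Fin w₁ → Bool) (M₂ : Fin w₂ → Fin w₂ → Bool) R R′ →
  w₁ ≤ N → w₂ ≤ N →
  Run N any₁F (mat R ∷ mat M₁ ∷ mat R′ ∷ mat M₂ ∷ nil ∷ [])
      (encodeBool (any (λ v₁ → any (meet M₁ M₂ R R′ v₁) (allFin w₁)) (allFin w₁))) p
any₁ʷ = _ , λ M₁ M₂ R R′ w₁≤N w₂≤N → anyʷ size
  (λ v₁ → callʷ (varʷ ∷ʷ varʷ ∷ʷ varʷ ∷ʷ varʷ ∷ʷ nilʷ ∷ʷ []ʷ) (proj₂ any₁′ʷ M₁ M₂ R R′ v₁ w₁≤N w₂≤N))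
  refl _ (length-allFin w₁≤N)

nodeRowʷ : ∃[ p ] ∀ {N w w₁ w₂} (M₁ : Fin w₁ → Fin w₁ → Bool) (M₂ : Fin w₂ → Fin w₂ → Bool)
  R (E : Fin w → Fin w₁ → Fin w₂ → Bool) → w ≤ N → w₁ ≤ N → w₂ ≤ N →
  Run N nodeRowF (fam (λ u → mat (E u)) ∷ fam (λ u → mat (E u)) ∷ mat R ∷ mat M₁ ∷ mat M₂ ∷ [])
      (row (λ u → any (λ v₁ → any (meet M₁ M₂ R (E u) v₁) (allFin w₁)) (allFin w₁))) p
nodeRowʷ = _ , λ M₁ M₂ R E w≤N w₁≤N w₂≤N → mapʷ size refl
  (λ u → callʷ (varʷ ∷ʷ varʷ ∷ʷ varʷ ∷ʷ varʷ ∷ʷ nilʷ ∷ʷ []ʷ) (proj₂ any₁ʷ M₁ M₂ R (E u) w₁≤N w₂≤N))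
  _ (length-allFin w≤N)

nodeMatʷ : ∃[ p ] ∀ {N w w₁ w₂} (M₁ : Fin w₁ → Fin w₁ → Bool) (M₂ : Fin w₂ → Fin w₂ → Bool)
  (E : Fin w → Fin w₁ → Fin w₂ → Bool) → w ≤ N → w₁ ≤ N → w₂ ≤ N →
  Run N nodeMatF (fam (λ u → mat (E u)) ∷ fam (λ u → mat (E u)) ∷ fam (λ u → mat (E u)) ∷
                  mat M₁ ∷ mat M₂ ∷ [])
      (mat (λ u u′ → any (λ v₁ → any (meet M₁ M₂ (E u) (E u′) v₁) (allFin w₁)) (allFin w₁))) p
nodeMatʷ = _ , λ M₁ M₂ E w≤N w₁≤N w₂≤N → mapʷ size refl
  (λ u → callʷ (varʷ ∷ʷ varʷ ∷ʷ varʷ ∷ʷ varʷ ∷ʷ varʷ ∷ʷ []ʷ)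
               (proj₂ nodeRowʷ M₁ M₂ (E u) E w≤N w₁≤N w₂≤N))
  _ (length-allFin w≤N)

widths≤ : ∀ {S₁ S₂ w₁ w₂ N} w (D₁ : Diagram S₁ w₁) (D₂ : Diagram S₂ w₂) →
          w + (∣ D₁ ∣ᴰ + ∣ D₂ ∣ᴰ) ≤ N → w ≤ N × w₁ ≤ N × w₂ ≤ N
widths≤ w D₁ D₂ le =
  m+n≤o⇒m≤o w le ,
  ≤-trans (width≤size D₁) (m+n≤o⇒m≤o _ (m+n≤o⇒n≤o w le)) ,
  ≤-trans (width≤size D₂) (m+n≤o⇒n≤o ∣ D₁ ∣ᴰ (m+n≤o⇒n≤o w le))

reachʷ : ∃[ p ] ∀ {n N S S′ w} → n ≤ N → (b : Leaf S → Fin n) → ∀ α α′ → length (leaves S) ≤ N →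
  (b′ : Leaf S′ → Fin n) (D : Diagram S′ w) → ∣ D ∣ᴰ ≤ N →
  Run N reachF (encodeDiagram′ b′ D ∷ assignment b α ∷ assignment b α′ ∷ nil ∷ nil ∷ [])
      (mat (reach D (linked b α α′ ∘ b′))) p
reachʷ = _ , λ n≤N b α α′ le → treeRecʷ refl (λ b′ D → mat (reach D (linked b α α′ ∘ b′)))
  (λ b′ label L w≤N →
    callʷ (varʷ ∷ʷ varʷ ∷ʷ varʷ ∷ʷ
           callʷ (varʷ ∷ʷ varʷ ∷ʷ varʷ ∷ʷ nilʷ ∷ʷ nilʷ ∷ʷ []ʷ)
                 (proj₂ linkedʷ n≤N b α α′ le (b′ here)) ∷ʷ nilʷ ∷ʷ []ʷ)
          (proj₂ leafMatʷ label _ w≤N (length-linked b α α′ (b′ here))))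
  (λ {w = w} b′ D₁ D₂ E E-P D≤N →
    let w≤N , w₁≤N , w₂≤N = widths≤ w D₁ D₂ D≤N in
    callʷ (varʷ ∷ʷ varʷ ∷ʷ varʷ ∷ʷ varʷ ∷ʷ varʷ ∷ʷ []ʷ)
          (proj₂ nodeMatʷ (reach D₁ (linked b α α′ ∘ b′ ∘ left)) (reach D₂ (linked b α α′ ∘ b′ ∘ right))
             E w≤N w₁≤N w₂≤N))

appendʷ : ∃[ p ] ∀ {n N S₁ S₂} (b : Leaf (node S₁ S₂) → Fin n) α₁ α₂ → length (leaves S₁) ≤ N →
  Run N appendF (assignment (b ∘ left) α₁ ∷ assignment (b ∘ left) α₁ ∷
                 assignment (b ∘ right) α₂ ∷ nil ∷ nil ∷ [])
      (assignment b (glue α₁ α₂)) p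
appendʷ = _ , λ {_} {_} {S₁} {S₂} b α₁ α₂ le →
  Run-≡ (append≡ b α₁ α₂ (leaves S₁))
    (loopʷ id refl size (λ _ _ → varʷ) (λ l r → varʷ ∙ʷ varʷ) (leaves S₁) le)
  where
  append≡ : ∀ {n S₁ S₂} (b : Leaf (node S₁ S₂) → Fin n) α₁ α₂ ls →
    foldr (λ l r → (encodeFin (b (left l)) ∙ encodeBool (α₁ l)) ∙ r) (assignment (b ∘ right) α₂) ls ≡
    encodeList (λ l → encodeFin (b l) ∙ encodeBool (glue α₁ α₂ l)) (map left ls ++ map right (leaves S₂))
  append≡ b α₁ α₂ []       = sym (encodeList-map right _)
  append≡ b α₁ α₂ (l ∷ ls) = cong (_ ∙_) (append≡ b α₁ α₂ ls)

candidateTrees : ∀ {n S w} → (Leaf S → Fin n) → Diagram S w → Tree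
candidateTrees b D = fam (λ u → encodeList (assignment b) (candidates D u))

leafCandʷ : ∃[ p ] ∀ {n N w} .{{_ : NonZero w}} (b : Leaf leaf → Fin n) label (L : IsLeafLabeling {w} label) →
  w ≤ N →
  Run N leafCandF (fam (λ u → encodeLabel (label u)) ∷ fam (λ u → encodeLabel (label u)) ∷
                   encodeFin (b here) ∷ nil ∷ nil ∷ [])
      (candidateTrees b (leaf label L)) p
leafCandʷ = _ , λ b label L w≤N → mapʷ size refl
  (λ u → match∙ʷ varʷ (ifʷ (encodeList (assignment b)) {b = ⟦ label u ⟧ false} varʷ
    (atTrueʷ b (# 1) (# 9) (⟦ label u ⟧ true) refl refl)
    (((varʷ ∙ʷ nilʷ) ∙ʷ nilʷ) ∙ʷ atTrueʷ b (# 3) (# 11) (⟦ label u ⟧ true) refl refl)))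
  _ (length-allFin w≤N)
  where
  atTrueʷ : ∀ {n N k} {ρ : Vec Tree k} (b : Leaf leaf → Fin n) t x c →
    lookup ρ t ≡ encodeBool c → lookup ρ x ≡ encodeFin (b here) →
    W N ρ (atTrueE t x) (encodeList (assignment b) (if c then (λ _ → true) ∷ [] else []))
      (con 1 ⊕ (con 1 ⊕ (con 1 ⊕ (con 1 ⊕ ((con 1 ⊕ ((con 1 ⊕ (con 1 ⊕ con 3)) ⊕ con 1)) ⊕ con 1)))))
  atTrueʷ b t x c eq eq′ = ifʷ (encodeList (assignment b)) {b = c} (varʷ≡ eq) nilʷ
    (((varʷ≡ eq′ ∙ʷ trueʷ) ∙ʷ nilʷ) ∙ʷ nilʷ)

innerʷ : ∃[ p ] ∀ {n N S₁ S₂ w₂} (b : Leaf (node S₁ S₂) → Fin n) (D₂ : Diagram S₂ w₂) (R : Fin w₂ → Bool) α₁ αs →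
  length (leaves S₁) ≤ N → w₂ ≤ N →
  Run N innerF (row R ∷ candidateTrees (b ∘ right) D₂ ∷ assignment (b ∘ left) α₁ ∷
                encodeList (assignment b) αs ∷ nil ∷ [])
      (encodeList (assignment b)
        (foldr (extend R (candidates D₂) α₁) αs (allFin w₂))) p
innerʷ = _ , λ b D₂ R α₁ αs le w₂≤N → loopʷ (encodeList (assignment b)) refl size
  (λ _ _ → varʷ)
  (λ v₂ r → ifʷ (encodeList (assignment b)) {b = R v₂} varʷ varʷ
    (headʷ (encodeList (assignment b)) {is = candidates D₂ v₂} {z = r} {f = λ α₂ → glue α₁ α₂ ∷ r} varʷ varʷ
      λ α₂ _ → callʷ (varʷ ∷ʷ varʷ ∷ʷ varʷ ∷ʷ nilʷ ∷ʷ nilʷ ∷ʷ []ʷ) (proj₂ appendʷ b α₁ α₂ le) ∙ʷ varʷ))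
  _ (length-allFin w₂≤N)

outerʷ : ∃[ p ] ∀ {n N S₁ S₂ w₁ w₂} (b : Leaf (node S₁ S₂) → Fin n) (D₁ : Diagram S₁ w₁)
  (D₂ : Diagram S₂ w₂) (R : Fin w₁ → Fin w₂ → Bool) →
  length (leaves S₁) ≤ N → w₁ ≤ N → w₂ ≤ N →
  Run N outerF (mat R ∷ candidateTrees (b ∘ left) D₁ ∷ candidateTrees (b ∘ right) D₂ ∷ nil ∷ nil ∷ [])
      (encodeList (assignment b)
        (foldr (extendAll R (candidates D₁) (candidates D₂)) [] (allFin w₁))) p
outerʷ = _ , λ {_} {_} {_} {_} {w₁} {w₂} b D₁ D₂ R le w₁≤N w₂≤N →
  loopʷ (encodeList (assignment b)) refl size
  (λ _ _ → nilʷ)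
  (λ v₁ r → headʷ (encodeList (assignment b)) {is = candidates D₁ v₁} {z = r}
    {f = λ α₁ → foldr (extend (R v₁) (candidates D₂) α₁) r (allFin w₂)} varʷ varʷ
    λ α₁ _ → callʷ (varʷ ∷ʷ varʷ ∷ʷ varʷ ∷ʷ varʷ ∷ʷ nilʷ ∷ʷ []ʷ) (proj₂ innerʷ b D₂ (R v₁) α₁ r le w₂≤N))
  _ (length-allFin w₁≤N)

nodeCandʷ : ∃[ p ] ∀ {n N S₁ S₂ w w₁ w₂} .{{_ : NonZero w}} (b : Leaf (node S₁ S₂) → Fin n) (D₁ : Diagram S₁ w₁)
  (D₂ : Diagram S₂ w₂) E (E-P : IsPartition {w} E) →
  length (leaves S₁) ≤ N → w ≤ N → w₁ ≤ N → w₂ ≤ N →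
  Run N nodeCandF (fam (λ u → mat (E u)) ∷ fam (λ u → mat (E u)) ∷
                   candidateTrees (b ∘ left) D₁ ∷ candidateTrees (b ∘ right) D₂ ∷ nil ∷ [])
      (candidateTrees b (node D₁ D₂ E E-P)) p
nodeCandʷ = _ , λ b D₁ D₂ E E-P le w≤N w₁≤N w₂≤N → mapʷ size refl
  (λ u → callʷ (varʷ ∷ʷ varʷ ∷ʷ varʷ ∷ʷ nilʷ ∷ʷ nilʷ ∷ʷ []ʷ) (proj₂ outerʷ b D₁ D₂ (E u) le w₁≤N w₂≤N))
  _ (length-allFin w≤N)

leaves≤size : ∀ {S w} (D : Diagram S w) → length (leaves S) ≤ ∣ D ∣ᴰ
leaves≤size (leaf {suc w} _ _) = s≤s z≤n
leaves≤size (node {S₁} {S₂} {w} D₁ D₂ _ _)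
  rewrite length-++ (map left (leaves S₁)) {map right (leaves S₂)}
        | length-map (left {S₁} {S₂}) (leaves S₁) | length-map (right {S₁} {S₂}) (leaves S₂) =
  ≤-trans (+-mono-≤ (leaves≤size D₁) (leaves≤size D₂)) (m≤n+m _ w)

-- An inner node has at most one candidate for each pair of child nodes; the summand 2 covers the
-- two values at a leaf.
length-candidates : ∀ {S w N} (D : Diagram S w) u → ∣ D ∣ᴰ ≤ N → length (candidates D u) ≤ N * N + 2
length-candidates {N = N} (leaf label L) u _ = ≤-trans leaf-bound (m≤n+m 2 (N * N))
  where
  leaf-bound : length (candidates (leaf label L) u) ≤ 2
  leaf-bound with ⟦ label u ⟧ false | ⟦ label u ⟧ true
  ... | false | false = z≤n
  ... | false | true  = s≤s z≤n
  ... | true  | false = s≤s z≤n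
  ... | true  | true  = ≤-refl
length-candidates {N = N} (node {w = w} {w₁} {w₂} D₁ D₂ E _) u D≤N =
  ≤-trans (length-foldr _ [] outer (allFin w₁)) (+-mono-≤ (*-mono-≤ (length-allFin w₁≤N) w₂≤N) z≤n)
  where
  w₁≤N : w₁ ≤ N
  w₁≤N = proj₁ (proj₂ (widths≤ w D₁ D₂ D≤N))
  w₂≤N : w₂ ≤ N
  w₂≤N = proj₂ (proj₂ (widths≤ w D₁ D₂ D≤N))
  inner : ∀ v₁ α₁ v₂ r → length (extend (E u v₁) (candidates D₂) α₁ v₂ r) ≤ 1 + length r
  inner v₁ α₁ v₂ r with E u v₁ v₂ | candidates D₂ v₂
  ... | false | _     = n≤1+n _
  ... | true  | []    = n≤1+n _
  ... | true  | _ ∷ _ = ≤-refl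
  outer : ∀ v₁ r → length (extendAll (E u) (candidates D₁) (candidates D₂) v₁ r) ≤ w₂ + length r
  outer v₁ r with candidates D₁ v₁
  ... | []     = m≤n+m _ w₂
  ... | α₁ ∷ _ = ≤-trans (length-foldr _ r (inner v₁ α₁) (allFin w₂))
    (≤-reflexive (cong (_+ length r) (trans (*-identityʳ _) (length-tabulate id))))

notʷ : ∀ {N k} {ρ : Vec Tree k} {e a p} → W N ρ e (encodeBool a) p →
       W N ρ (match e `true nil) (encodeBool (not a)) (con 1 ⊕ (p ⊕ (con 3 ⊕ con 1)))
notʷ {a = false} w = ifʷ encodeBool {b = false} {x = false} w trueʷ nilʷ
notʷ {a = true}  w = ifʷ encodeBool {b = true} {y = true} w trueʷ nilʷ

agreeʷ : ∃[ p ] ∀ {n N S S′} → n ≤ N → (b : Leaf S → Fin n) → ∀ α α′ → length (leaves S) ≤ N →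
  (b′ : Leaf S′ → Fin n) (D′ : Diagram S′ 2) → ∣ D′ ∣ᴰ ≤ N →
  Run N agreeF (assignment b α ∷ assignment b α′ ∷ encodeDiagram′ b′ D′ ∷ nil ∷ nil ∷ [])
      (encodeBool (agree D′ b′ b α α′)) p
agreeʷ = _ , λ n≤N b α α′ le b′ D′ D′≤N →
  Run-≡ (cong encodeBool (nor (reach D′ (linked b α α′ ∘ b′) 0F 1F) _)) (run
    (match∙ʷ (callʷ (varʷ ∷ʷ varʷ ∷ʷ varʷ ∷ʷ nilʷ ∷ʷ nilʷ ∷ʷ []ʷ) (proj₂ reachʷ n≤N b α α′ le b′ D′ D′≤N))
    (match∙ʷ varʷ (match∙ʷ varʷ
      (ifʷ encodeBool {b = reach D′ (linked b α α′ ∘ b′) 0F 1F} {x = false}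
           {y = if reach D′ (linked b α α′ ∘ b′) 1F 0F then false else true} varʷ
        (match∙ʷ varʷ (match∙ʷ varʷ
          (ifʷ encodeBool {b = reach D′ (linked b α α′ ∘ b′) 1F 0F} {x = false} {y = true} varʷ
            trueʷ nilʷ)))
        nilʷ)))))
  where
  nor : ∀ x y → (if x then false else if y then false else true) ≡ not x ∧ not y
  nor true  _     = refl
  nor false true  = refl
  nor false false = refl

consistentʷ : ∃[ p ] ∀ {n N S S′} → n ≤ N → (b : Leaf S → Fin n) → ∀ α αs → length αs ≤ N * N + 2 →
  length (leaves S) ≤ N → (b′ : Leaf S′ → Fin n) (D′ : Diagram S′ 2) → ∣ D′ ∣ᴰ ≤ N →
  Run N consistentF (encodeList (assignment b) αs ∷ encodeList (assignment b) αs ∷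
                     assignment b α ∷ encodeDiagram′ b′ D′ ∷ nil ∷ [])
      (encodeBool (all (agree D′ b′ b α) αs)) p
consistentʷ = _ , λ n≤N b α αs len le b′ D′ D′≤N → allʷ (size ⊗ size ⊕ con 2)
  (λ α′ → callʷ (varʷ ∷ʷ varʷ ∷ʷ varʷ ∷ʷ nilʷ ∷ʷ nilʷ ∷ʷ []ʷ)
                (proj₂ agreeʷ n≤N b α α′ le b′ D′ D′≤N))
  refl αs len

localʷ : ∃[ p ] ∀ {n N S S′ w} → n ≤ N → (b : Leaf S → Fin n) (D : Diagram S w) → ∣ D ∣ᴰ ≤ N →
  (b′ : Leaf S′ → Fin n) (D′ : Diagram S′ 2) → ∣ D′ ∣ᴰ ≤ N →
  Run N localF (candidateTrees b D ∷ candidateTrees b D ∷ encodeDiagram′ b′ D′ ∷ nil ∷ nil ∷ [])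
      (encodeBool (localCheck (agree D′ b′) b D)) p
localʷ = _ , λ {_} {N} n≤N b D D≤N b′ D′ D′≤N → allʷ size
  (λ u → consistentHeadʷ (candidates D u) varʷ
    λ α αs eq → callʷ (varʷ ∷ʷ varʷ ∷ʷ varʷ ∷ʷ varʷ ∷ʷ nilʷ ∷ʷ []ʷ)
      (proj₂ consistentʷ n≤N b α αs
        (≤-trans (n≤1+n _) (subst (λ l → length l ≤ N * N + 2) eq (length-candidates D u D≤N)))
        (≤-trans (leaves≤size D) D≤N) b′ D′ D′≤N))
  refl _ (length-allFin (≤-trans (width≤size D) D≤N))
  where
  -- In contrast to `headʷ`, the branch receives the equation for the list, from which the length
  -- bound on its tail is derived.
  consistentHeadʷ : ∀ {N k} {ρ : Vec Tree k} {A : Set} {X : A → Tree} {test : A → A → Bool} αs {e e₁ p q} →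
    W N ρ e (encodeList X αs) p →
    (∀ α αs′ → αs ≡ α ∷ αs′ → W N (X α ∷ encodeList X αs′ ∷ ρ) e₁ (encodeBool (all (test α) αs′)) q) →
    W N ρ (match e `true e₁) (encodeBool (consistent test αs)) (con 1 ⊕ (p ⊕ (con 3 ⊕ q)))
  consistentHeadʷ {N} [] {p = p} w _ = weaken _ (matchnilʷ w trueʷ) (s≤s (+-monoʳ-≤ (⟪ p ⟫ N) (m≤m+n 3 _)))
  consistentHeadʷ {N} (α ∷ αs) {p = p} w w₁ =
    weaken _ (match∙ʷ w (w₁ α αs refl)) (s≤s (+-monoʳ-≤ (⟪ p ⟫ N) (m≤n+m _ 3)))

processʷ : ∃[ p ] ∀ {n N S S′ w} → n ≤ N → (b′ : Leaf S′ → Fin n) (D′ : Diagram S′ 2) → ∣ D′ ∣ᴰ ≤ N →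
  (b : Leaf S → Fin n) (D : Diagram S w) → ∣ D ∣ᴰ ≤ N →
  Run N processF (encodeDiagram′ b D ∷ encodeDiagram′ b′ D′ ∷ nil ∷ nil ∷ nil ∷ [])
      (encodeBool (checks (agree D′ b′) b D) ∙ candidateTrees b D) p
processʷ = _ , λ n≤N b′ D′ D′≤N → treeRecʷ refl
  (λ b D → encodeBool (checks (agree D′ b′) b D) ∙ candidateTrees b D)
  (λ {w} b label L w≤N →
    letʷ (callʷ (varʷ ∷ʷ varʷ ∷ʷ varʷ ∷ʷ nilʷ ∷ʷ nilʷ ∷ʷ []ʷ) (proj₂ leafCandʷ b label L w≤N))
      (callʷ (varʷ ∷ʷ varʷ ∷ʷ varʷ ∷ʷ nilʷ ∷ʷ nilʷ ∷ʷ []ʷ)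
             (proj₂ localʷ n≤N b (leaf label L) w≤N b′ D′ D′≤N) ∙ʷ varʷ))
  (λ {w = w} b D₁ D₂ E E-P D≤N →
    let w≤N , w₁≤N , w₂≤N = widths≤ w D₁ D₂ D≤N
        D₁≤N = m+n≤o⇒m≤o ∣ D₁ ∣ᴰ (m+n≤o⇒n≤o w D≤N)
    in
    match∙ʷ varʷ (match∙ʷ varʷ
      (letʷ (callʷ (varʷ ∷ʷ varʷ ∷ʷ varʷ ∷ʷ varʷ ∷ʷ nilʷ ∷ʷ []ʷ)
                   (proj₂ nodeCandʷ b D₁ D₂ E E-P (≤-trans (leaves≤size D₁) D₁≤N) w≤N w₁≤N w₂≤N))
        (andʷ {a = checks (agree D′ b′) (b ∘ left) D₁} varʷ
          (andʷ {a = checks (agree D′ b′) (b ∘ right) D₂} varʷ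
            (callʷ (varʷ ∷ʷ varʷ ∷ʷ varʷ ∷ʷ nilʷ ∷ʷ nilʷ ∷ʷ []ʷ)
                   (proj₂ localʷ n≤N b (node D₁ D₂ E E-P) D≤N b′ D′ D′≤N))) ∙ʷ varʷ))))

rootʷ : ∃[ p ] ∀ {n N S S′} → n ≤ N → (b : Leaf S → Fin n) → length (leaves S) ≤ N → ∀ αs e →
  (b′ : Leaf S′ → Fin n) (D′ : Diagram S′ 2) → ∣ D′ ∣ᴰ ≤ N → ∀ o′ →
  Run N rootF (encodeList (assignment b) αs ∷ encodeBool e ∷ encodeFin o′ ∷ encodeDiagram′ b′ D′ ∷ nil ∷ [])
      (encodeBool (rootCheck b αs e D′ b′ o′)) p
rootʷ = _ , λ n≤N b le αs e b′ D′ D′≤N o′ → run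
  (headʷ encodeBool {is = αs} {z = true} {f = λ α → iff (reach D′ (linked b α α ∘ b′) o′ o′) e} varʷ trueʷ
    λ α _ → letʷ
      (match∙ʷ (callʷ (varʷ ∷ʷ varʷ ∷ʷ varʷ ∷ʷ nilʷ ∷ʷ nilʷ ∷ʷ []ʷ)
                      (proj₂ reachʷ n≤N b α α le b′ D′ D′≤N))
        (diagonalʷ (reach D′ (linked b α α ∘ b′)) o′))
      (ifʷ encodeBool {b = reach D′ (linked b α α ∘ b′) o′ o′} {x = e} {y = not e} varʷ
        (notʷ {a = e} varʷ) varʷ))
  where
  diagonalʷ : ∀ {N} (M : Fin 2 → Fin 2 → Bool) o {t₁ t₂ t₃ t₄ t₅ t₆} →
    W N (row (M 0F) ∷ (row (M 1F) ∙ nil) ∷ t₁ ∷ t₂ ∷ t₃ ∷ t₄ ∷ encodeFin o ∷ t₅ ∷ t₆ ∷ [])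
      (match (v 6) (match (v 0) nil (v 0)) (match (v 3) nil (match (v 0) nil (match (v 1) nil (v 0)))))
      (encodeBool (M o o)) (con 9)
  diagonalʷ M 0F = weaken _ (matchnilʷ varʷ (match∙ʷ varʷ varʷ)) (m≤m+n 5 4)
  diagonalʷ M 1F = weaken _ (match∙ʷ varʷ (match∙ʷ varʷ (match∙ʷ varʷ (match∙ʷ varʷ varʷ)))) ≤-refl

-- Abstract, because the normal form of the inferred polynomial is enormous.
abstract

  decideʷ : ∃[ p ] ∀ {n N S S′} → n ≤ N →
    (b : Leaf S → Fin n) (D : Diagram S 2) → ∣ D ∣ᴰ ≤ N → ∀ t o →
    (b′ : Leaf S′ → Fin n) (D′ : Diagram S′ 2) → ∣ D′ ∣ᴰ ≤ N → ∀ t′ o′ →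
    W N (((t ∙ encodeFin o ∙ encodeDiagram′ b D) ∙ t′ ∙ encodeFin o′ ∙ encodeDiagram′ b′ D′) ∷ []) mainE
      (encodeBool (decide D b o D′ b′ o′)) p
  decideʷ = _ , λ n≤N b D D≤N t o b′ D′ D′≤N t′ o′ →
    let le = ≤-trans (leaves≤size D) D≤N in
    match∙ʷ varʷ (match∙ʷ varʷ (match∙ʷ varʷ (match∙ʷ varʷ (match∙ʷ varʷ
    (match∙ʷ (callʷ (varʷ ∷ʷ varʷ ∷ʷ nilʷ ∷ʷ nilʷ ∷ʷ nilʷ ∷ʷ []ʷ) (proj₂ processʷ n≤N b′ D′ D′≤N b D D≤N))
    (match∙ʷ varʷ (match∙ʷ varʷ
      (andʷ {a = checks (agree D′ b′) b D} varʷ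
        (andʷ {a = rootCheck b (candidates D 0F) (does (0F ≟ o)) D′ b′ o′}
          (callʷ (varʷ ∷ʷ rejectsʷ o refl ∷ʷ varʷ ∷ʷ varʷ ∷ʷ nilʷ ∷ʷ []ʷ)
                 (proj₂ rootʷ n≤N b le (candidates D 0F) (does (0F ≟ o)) b′ D′ D′≤N o′))
          (callʷ (varʷ ∷ʷ varʷ≡ (encodeFin≡ o) ∷ʷ varʷ ∷ʷ varʷ ∷ʷ nilʷ ∷ʷ []ʷ)
                 (proj₂ rootʷ n≤N b le (candidates D 1F) (does (1F ≟ o)) b′ D′ D′≤N o′)))))))))))
    where
    encodeFin≡ : (o : Fin 2) → encodeFin o ≡ encodeBool (does (1F ≟ o))
    encodeFin≡ 0F = refl
    encodeFin≡ 1F = refl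
    rejectsʷ : ∀ {N k} {ρ : Vec Tree k} {i} (o : Fin 2) → lookup ρ i ≡ encodeFin o →
      W N ρ (match (var i) `true nil) (encodeBool (does (0F ≟ o))) (con 1 ⊕ (con 1 ⊕ (con 3 ⊕ con 1)))
    rejectsʷ 0F eq = notʷ {a = false} (varʷ≡ eq)
    rejectsʷ 1F eq = notʷ {a = true} (varʷ≡ eq)

-- Monomial bounds and assembly

^-bound : ∀ {N} → 1 ≤ N → ∀ {m m′} c k c′ k′ → m ≤ c * N ^ k → m′ ≤ c′ * N ^ k′ →
          m + m′ ≤ (c + c′) * N ^ (k + k′)
^-bound {N@(suc _)} _ c k c′ k′ le le′ =
  ≤-trans (+-mono-≤ (≤-trans le (*-monoʳ-≤ c (^-monoʳ-≤ N (m≤m+n k k′))))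
                    (≤-trans le′ (*-monoʳ-≤ c′ (^-monoʳ-≤ N (m≤n+m k′ k)))))
          (≤-reflexive (sym (*-distribʳ-+ (N ^ (k + k′)) c c′)))

-- For `1 ≤ N` powers of `N` grow with the exponent, so the sum of two exponents serves as a common
-- exponent for both summands of `p ⊕ q`.
Poly-bound : ∀ p → Σ[ C ∈ ℕ ] Σ[ k ∈ ℕ ] (∀ {N} → 1 ≤ N → ⟪ p ⟫ N ≤ C * N ^ k)
Poly-bound (con c) = c , 0 , λ _ → ≤-reflexive (sym (*-identityʳ c))
Poly-bound size    = 1 , 1 , λ {N} _ → ≤-reflexive (sym (trans (*-identityˡ (N * 1)) (*-identityʳ N)))
Poly-bound (p ⊕ q) with C , k , le ← Poly-bound p | C′ , k′ , le′ ← Poly-bound q =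
  C + C′ , k + k′ , λ 1≤N → ^-bound 1≤N C k C′ k′ (le 1≤N) (le′ 1≤N)
Poly-bound (p ⊗ q) with C , k , le ← Poly-bound p | C′ , k′ , le′ ← Poly-bound q =
  C * C′ , k + k′ , λ {N} 1≤N → ≤-trans (*-mono-≤ (le 1≤N) (le′ 1≤N))
    (≤-reflexive (trans ([m*n]*[o*p]≡[m*o]*[n*p] C (N ^ k) C′ (N ^ k′))
                        (cong (C * C′ *_) (sym (^-distribˡ-+-* N k k′)))))

-- Variables are compared in unary, at a cost linear in their number; this bounds that number by the
-- number of leaves and thereby by the size.
variables≤leaves : ∀ {n S} (b : Leaf S → Fin n) (leafOf : Fin n → Leaf S) →
                   (∀ x → b (leafOf x) ≡ x) → n ≤ length (leaves S)
variables≤leaves {n} {S} b leafOf b-leafOf = injective⇒≤ {f = position} position-inj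
  where
  position : Fin n → Fin (length (leaves S))
  position x = index (∈-leaves (leafOf x))
  leaf-at : ∀ x → b (List.lookup (leaves S) (position x)) ≡ x
  leaf-at x = trans (cong b (sym (lookup-index (∈-leaves (leafOf x))))) (b-leafOf x)
  position-inj : Injective _≡_ _≡_ position
  position-inj {x} {y} eq =
    trans (sym (leaf-at x)) (trans (cong (b ∘ List.lookup (leaves S)) eq) (leaf-at y))

record Enumerated {n S} (b : Leaf S → Fin n) : Set where
  field
    injective : Injective _≡_ _≡_ b
    leafOf    : Fin n → Leaf S
    b-leafOf  : ∀ x → b (leafOf x) ≡ x
    leafOf-b  : ∀ l → leafOf (b l) ≡ l

enumerate : ∀ {n S} (labeling : Leaf S ⤖ Fin n) → Enumerated (Bijection.to labeling)
enumerate labeling = record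
  { injective = Bijection.injective labeling
  ; leafOf    = Bijection.to⁻ labeling
  ; b-leafOf  = λ x → proj₂ (Bijection.strictlySurjective labeling x)
  ; leafOf-b  = λ l → Bijection.injective labeling (proj₂ (Bijection.strictlySurjective labeling _))
  }

width≡2 : ∀ {w} → Bool ⤖ Fin w → w ≡ 2
width≡2 output = sym (↔⇒≡ (⤖⇒↔ output ↔-∘ 2↔Bool))

lemma15 : Σ[ P ∈ Program ] Σ[ C ∈ ℕ ] Σ[ k ∈ ℕ ]
    (∀ {n} {V V′ : Vtree n} (D : BooleanTDD V) (D′ : BooleanTDD V′) →
    Σ[ answer ∈ Bool ] Σ[ time ∈ ℕ ]
    (P on (encodeTDD D ∙ encodeTDD D′) yields encodeBool answer inTime time)
    × (time ≤ C * (TDD.size D + TDD.size D′) ^ k)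
    × (answer ≡ true ⇔ D ≋ D′))
lemma15 with C , k , bound ← Poly-bound (proj₁ decideʷ) = program , C , k , correct C k bound
  where
  correct : ∀ C k → (∀ {N} → 1 ≤ N → ⟪ proj₁ decideʷ ⟫ N ≤ C * N ^ k) →
    ∀ {n} {V V′ : Vtree n} (D : BooleanTDD V) (D′ : BooleanTDD V′) →
    Σ[ answer ∈ Bool ] Σ[ time ∈ ℕ ]
    (program on (encodeTDD D ∙ encodeTDD D′) yields encodeBool answer inTime time)
    × (time ≤ C * (TDD.size D + TDD.size D′) ^ k)
    × (answer ≡ true ⇔ D ≋ D′)
  correct C k bound {V = V} {V′}
    T@(record { width = w ; diagram = D ; output = output })
    T′@(record { width = w′ ; diagram = D′ ; output = output′ })
    -- The record patterns have made the widths variables, so both can be set to 2, the number of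
    -- root nodes for which `decide` is defined.
    with refl ← width≡2 output | refl ← width≡2 output′ =
    decide D b o D′ b′ o′ , W.cost run-W ,
    W.derivation run-W ,
    ≤-trans (W.bound run-W) (bound (≤-trans (s≤s z≤n) size≥2)) ,
    decide⇔ D′ b′ (Enumerated.leafOf e′) (Enumerated.b-leafOf e′) (Enumerated.leafOf-b e′)
            D b (Enumerated.injective e) (Enumerated.leafOf e) (Enumerated.b-leafOf e) o o′
    where
    b  = Vtree.var V
    b′ = Vtree.var V′
    e  = enumerate (Vtree.labeling V)
    e′ = enumerate (Vtree.labeling V′)
    o  = Bijection.to output true
    o′ = Bijection.to output′ true
    N  = ∣ D ∣ᴰ + ∣ D′ ∣ᴰ
    size≥2 : 2 ≤ N
    size≥2 = ≤-trans (width≤size D) (m≤m+n _ _)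
    n≤N : _ ≤ N
    n≤N = ≤-trans (variables≤leaves b (Enumerated.leafOf e) (Enumerated.b-leafOf e))
                  (≤-trans (leaves≤size D) (m≤m+n _ _))
    input≡ : encodeTDD T ∙ encodeTDD T′ ≡
             (encodeFin (Bijection.to output false) ∙ encodeFin o ∙ encodeDiagram′ b D) ∙
             (encodeFin (Bijection.to output′ false) ∙ encodeFin o′ ∙ encodeDiagram′ b′ D′)
    input≡ = cong₂ (λ t t′ → (_ ∙ _ ∙ t) ∙ (_ ∙ _ ∙ t′)) (encodeDiagram≡ b D) (encodeDiagram≡ b′ D′)
    run-W : W N ((encodeTDD T ∙ encodeTDD T′) ∷ []) mainE (encodeBool (decide D b o D′ b′ o′))
              (proj₁ decideʷ)
    run-W = subst (λ t → W N (t ∷ []) mainE (encodeBool (decide D b o D′ b′ o′)) (proj₁ decideʷ))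
      (sym input≡)
      (proj₂ decideʷ n≤N b D (m≤m+n _ _) (encodeFin (Bijection.to output false)) o
                     b′ D′ (m≤n+m _ ∣ D ∣ᴰ) (encodeFin (Bijection.to output′ false)) o′)
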